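{- Let $t>1$ be odd and $G=\mathbb{Z}_t\times\mathbb{Z}_2^2$ with elements indexed by $\{1,\ldots,4t\}$ so that index $i$ corresponds to $\big(\lfloor (i-1)/4\rfloor,\lfloor [i-1]_4/2\rfloor,[i-1]_2\big)$. Let $\rho$ be the normalized cocycle whose matrix is $$M_\rho=(r_{i,j})=J_t\otimes\begin{pmatrix}1&1&1&1\\1&-1&1&-1\\1&-1&-1&1\\1&1&-1&-1\end{pmatrix},$$ $J_t$ the $t\times t$ all-ones matrix. Let $\mathbb{Q}[X]=\mathbb{Q}[x_1,\ldots,x_{4t-3}]$, where $x_{h-1}$ is associated with the coboundary $\partial_h$, $2\le h\le 4t-2$. Let $\chi(i)=1$ if $2\le i\le 4t-2$ and $\chi(i)=0$ otherwise. For $1\le l\le 2t-2$ and $1\le h\le 4t$ put $$s_{l,h}(X):=r_{l+4,h}\,(1-2x_{h-1})^{\chi(h)}\,(1-2x_{j(l+4,h)-1})^{\chi(j(l+4,h))},$$ where $$j(s,c):=1+4\Big[\Big\lfloor\tfrac{s-1}{4}\Big\rfloor+\Big\lfloor\tfrac{c-1}{4}\Big\rfloor\Big]_t+2\Big[\Big\lfloor\tfrac{[s-1]_4}{2}\Big\rfloor+\Big\lfloor\tfrac{[c-1]_4}{2}\Big\rfloor\Big]_2+[s+c]_2$$ (a factor with exponent $0$ is $1$). Let $$J_{\mathbb{Z}_t\times\mathbb{Z}_2^2}:=\langle x_i^2-x_i: 1\le i\le 4t-3\rangle+\Big\langle \sum_{h=1}^{4t}s_{l,h}(X): 1\le l\le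 2t-2\Big\rangle\subset\mathbb{Q}[X].$$ Then this ideal is zero-dimensional and its variety is exactly the set of $(x_1,\ldots,x_{4t-3})\in\{0,1\}^{4t-3}$ such that the cocyclic matrix of $\psi=\rho\prod_{h=2}^{4t-2}\partial_h^{x_{h-1}}$ is Hadamard; that is, it is in bijection with the set $\mathcal{H}^\rho_{\mathbb{Z}_t\times\mathbb{Z}_2^2}$ of normalized cocyclic Hadamard matrices over $G$ of the form $M_\rho\circ\prod_{h=2}^{4t-2}M_{\partial_h}^{x_{h-1}}$. Moreover $|\mathcal{H}^\rho_{\mathbb{Z}_t\times\mathbb{Z}_2^2}|=\dim_{\mathbb{Q}}(\mathbb{Q}[X]/J_{\mathbb{Z}_t\times\mathbb{Z}_2^2})$.
   Context: $[n]_m$ denotes $n\bmod m$. A normalized cocycle over $G$ is a map $\psi:G\times G\to\{\pm1\}$ with $\psi(g_i,g_j)\psi(g_i+g_j,g_k)=\psi(g_j,g_k)\psi(g_i,g_j+g_k)$ and $\psi(0,g)=\psi(g,0)=1$; its cocyclic matrix is $M_\psi=(\psi(g_i,g_j))$. For $g_d\in G$, $\delta_{g_d}$ is $-1$ at $g_d$ and $1$ elsewhere, and the elementary coboundary is $\partial_d(g_i,g_j)=\delta_{g_d}(g_i)\delta_{g_d}(g_j)\delta_{g_d}(g_i+g_j)$. Cocycles are multiplied pointwise; $\circ$ and products of matrices above denote entrywise (Hadamard) products. The set $\{\partial_2,\ldots,\partial_{4t-2}\}$ together with three representative cocycles (whose product is $\rho$) forms a basis of normalized cocycles over $G$. A Hadamard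 matrix of order $n$ is an $n\times n$ $\pm1$ matrix with $HH^T=nI$. -}

module Defs where

open import Data.Nat as ℕ using (ℕ; zero; suc; NonZero; _∸_; _≤ᵇ_; _≡ᵇ_)
open import Data.Nat.DivMod using (_/_; _%_)
open import Data.Integer as ℤ using (ℤ)
open import Data.Rational as ℚ using (ℚ; 0ℚ; 1ℚ)
open import Data.Bool using (Bool; true; false; if_then_else_; _∧_)
open import Data.Vec as V using (Vec)
open import Data.Vec.Properties using (≡-dec)
open import Data.List as L using (List; []; _∷_)
open import Data.Fin using (Fin; toℕ)
open import Data.Product using (_×_; _,_; Σ; ∃)
open import Relation.Nullary using (does)
open import Relation.Binary.PropositionalEquality using (_≡_)

range : ℕ → ℕ → List ℕ
range lo hi = L.map (lo ℕ.+_) (L.upTo (suc hi ∸ lo))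

∑ℤ : ℕ → ℕ → (ℕ → ℤ) → ℤ
∑ℤ lo hi f = L.foldr (λ k acc → f k ℤ.+ acc) (ℤ.+ 0) (range lo hi)

∏ℤ : ℕ → ℕ → (ℕ → ℤ) → ℤ
∏ℤ lo hi f = L.foldr (λ k acc → f k ℤ.* acc) (ℤ.+ 1) (range lo hi)

-- 1-based lookup x_k (k = 1, ..., m) in a vector; default outside range
at : {A : Set} {m : ℕ} → Vec A m → A → ℕ → A
at V.[] d k = d
at (a V.∷ v) d zero = d
at (a V.∷ v) d (suc zero) = a
at (a V.∷ v) d (suc (suc k)) = at v d (suc k)

IsHadamard : ℕ → (ℕ → ℕ → ℤ) → Set
IsHadamard n M = ∀ i j → 1 ℕ.≤ i → i ℕ.≤ n → 1 ℕ.≤ j → j ℕ.≤ n →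
  ∑ℤ 1 n (λ k → M i k ℤ.* M j k) ≡ (if i ≡ᵇ j then ℤ.+ n else ℤ.+ 0)

boolℚ : Bool → ℚ
boolℚ false = 0ℚ
boolℚ true = 1ℚ

ℤtoℚ : ℤ → ℚ
ℤtoℚ z = z ℚ./ 1

-- Multivariate polynomials over ℚ in N variables x_1, ..., x_N:
-- finite formal sums of terms c · x^m, with m an exponent vector.
-- Two polynomials are equal iff all their coefficients agree.

Mono : ℕ → Set
Mono N = Vec ℕ N

Poly : ℕ → Set
Poly N = List (ℚ × Mono N)

module _ {N : ℕ} where

  coeff : Poly N → Mono N → ℚ
  coeff [] m = 0ℚ
  coeff ((c , m′) ∷ p) m =
    if does (≡-dec ℕ._≟_ m′ m) then c ℚ.+ coeff p m else coeff p m

  infix 4 _≈ₚ_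
  _≈ₚ_ : Poly N → Poly N → Set
  p ≈ₚ q = ∀ m → coeff p m ≡ coeff q m

  infixl 6 _+ₚ_ _-ₚ_
  infixl 7 _*ₚ_

  _+ₚ_ : Poly N → Poly N → Poly N
  p +ₚ q = p L.++ q

  -ₚ_ : Poly N → Poly N
  -ₚ p = L.map (λ { (c , m) → (ℚ.- c , m) }) p

  _-ₚ_ : Poly N → Poly N → Poly N
  p -ₚ q = p +ₚ (-ₚ q)

  _*ₚ_ : Poly N → Poly N → Poly N
  p *ₚ q = L.concatMap
    (λ { (c , m) → L.map (λ { (d , m′) → (c ℚ.* d , V.zipWith ℕ._+_ m m′) }) q }) p

  constₚ : ℚ → Poly N
  constₚ c = (c , V.replicate N 0) ∷ []

  varₚ : ℕ → Poly N
  varₚ k = (1ℚ , V.tabulate (λ i → if toℕ i ≡ᵇ (k ∸ 1) then 1 else 0)) ∷ []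

  ∑ₚ : ℕ → ℕ → (ℕ → Poly N) → Poly N
  ∑ₚ lo hi f = L.foldr (λ k acc → f k +ₚ acc) [] (range lo hi)

  powℚ : ℚ → ℕ → ℚ
  powℚ q zero = 1ℚ
  powℚ q (suc e) = q ℚ.* powℚ q e

  evalMono : Vec ℚ N → Mono N → ℚ
  evalMono a m = V.foldr _ ℚ._*_ 1ℚ (V.zipWith powℚ a m)

  evalₚ : Vec ℚ N → Poly N → ℚ
  evalₚ a p = L.foldr (λ { (c , m) acc → c ℚ.* evalMono a m ℚ.+ acc }) 0ℚ p

module _ (t : ℕ) .{{_ : NonZero t}} where

  nv : ℕ
  nv = 4 ℕ.* t ∸ 3

  -- j(s,c): the index of g_s + g_c
  jj : ℕ → ℕ → ℕ
  jj s c = 1 ℕ.+ 4 ℕ.* ((((s ∸ 1) / 4) ℕ.+ ((c ∸ 1) / 4)) % t)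
             ℕ.+ 2 ℕ.* (((((s ∸ 1) % 4) / 2) ℕ.+ (((c ∸ 1) % 4) / 2)) % 2)
             ℕ.+ ((s ℕ.+ c) % 2)

  -- the 4×4 kernel of M_ρ (0-based)
  h4 : ℕ → ℕ → ℤ
  h4 1 1 = ℤ.- ℤ.+ 1
  h4 1 3 = ℤ.- ℤ.+ 1
  h4 2 1 = ℤ.- ℤ.+ 1
  h4 2 2 = ℤ.- ℤ.+ 1
  h4 3 2 = ℤ.- ℤ.+ 1
  h4 3 3 = ℤ.- ℤ.+ 1
  h4 _ _ = ℤ.+ 1

  -- M_ρ = J_t ⊗ h4, entries r_{i,j} (1-based)
  r : ℕ → ℕ → ℤ
  r i j = h4 ((i ∸ 1) % 4) ((j ∸ 1) % 4)

  δ : ℕ → ℕ → ℤ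
  δ d i = if i ≡ᵇ d then ℤ.- ℤ.+ 1 else ℤ.+ 1

  ∂ : ℕ → ℕ → ℕ → ℤ
  ∂ d i j = δ d i ℤ.* δ d j ℤ.* δ d (jj i j)

  ψM : Vec Bool nv → ℕ → ℕ → ℤ
  ψM x i j = r i j ℤ.* ∏ℤ 2 (4 ℕ.* t ∸ 2)
    (λ h → if at x false (h ∸ 1) then ∂ h i j else ℤ.+ 1)

  fac : ℕ → Poly nv
  fac k = if (2 ≤ᵇ k) ∧ (k ≤ᵇ (4 ℕ.* t ∸ 2))
          then constₚ 1ℚ -ₚ constₚ (ℤtoℚ (ℤ.+ 2)) *ₚ varₚ (k ∸ 1)
          else constₚ 1ℚ

  s : ℕ → ℕ → Poly nv
  s l h = constₚ (ℤtoℚ (r (l ℕ.+ 4) h)) *ₚ fac h *ₚ fac (jj (l ℕ.+ 4) h)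

  fieldGen : ℕ → Poly nv
  fieldGen i = varₚ i *ₚ varₚ i -ₚ varₚ i

  S : ℕ → Poly nv
  S l = ∑ₚ 1 (4 ℕ.* t) (s l)

  InJ : Poly nv → Set
  InJ p = Σ (ℕ → Poly nv) λ c → Σ (ℕ → Poly nv) λ d →
    p ≈ₚ ∑ₚ 1 nv (λ i → c i *ₚ fieldGen i)
         +ₚ ∑ₚ 1 (2 ℕ.* t ∸ 2) (λ l → d l *ₚ S l)

  InV : Vec ℚ nv → Set
  InV a = ∀ p → InJ p → evalₚ a p ≡ 0ℚ

  lincomb : {d : ℕ} → (Fin d → ℚ) → (Fin d → Poly nv) → Poly nv
  lincomb {d} a b = L.foldr (λ i acc → constₚ (a i) *ₚ b i +ₚ acc) [] (L.allFin d)

  QuotDim : ℕ → Set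
  QuotDim d = Σ (Fin d → Poly nv) λ b →
    (∀ p → ∃ λ (a : Fin d → ℚ) → InJ (p -ₚ lincomb a b))
    × (∀ (a : Fin d → ℚ) → InJ (lincomb a b) → ∀ i → a i ≡ 0ℚ)

{-# OPTIONS --safe #-}

-- Write f for the product of the selected δ_h, so that ψ = ρ · ∂f.  Since ρ is bilinear, the inner
-- product of rows i ≠ j of M_ψ is ± R(i - j) with R(g) = ∑_k ρ(g,k) f(k) f(g+k), and the substitution
-- k ↦ g + k gives R(-g) = ρ(g,g) R(g).  As ρ(g,g) = -1 for every involution g, the matrix is Hadamard
-- iff R vanishes on a half-system of representatives of ± on the elements with ℤ_t-component ≠ 0;
-- the rows l+4, 1 ≤ l ≤ 2t-2, form one, and the l-th generator evaluates at x to R(l+4).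
--
-- For the dimension, the indicator polynomial E_v of a point v ∈ {0,1}ᴺ satisfies p E_v ≡ p(v) E_v
-- modulo the x_i² - x_i, and ∑_v E_v = 1.  If v is not in the variety then some generator is a nonzero
-- scalar on E_v, so E_v lies in the ideal.  Hence p ≡ ∑ p(v) E_v over the variety, and evaluation
-- at its points shows that these E_v are independent.
module Submission where

open import Defs
open import Algebra.Bundles using (AbelianGroup; CommutativeMonoid; CommutativeRing)
open import Algebra.Consequences.Setoid using (comm∧invʳ⇒inv; comm∧idˡ⇒id; comm∧distrʳ⇒distr)
import Algebra.Properties.CommutativeSemigroup
import Algebra.Properties.Group
import Algebra.Properties.Ring
open import Data.Bool using (Bool; true; false; if_then_else_; _∧_; T)
import Data.Bool.Properties as Bool
open import Data.Fin as F using (Fin; toℕ)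
open import Data.Fin.Patterns
import Data.Fin.Properties as F
open import Data.Integer as ℤ using (ℤ)
import Data.Integer.Properties as ℤ
import Data.Integer.Solver
open import Data.List as L using (List; []; _∷_; length)
import Data.List.Properties as L
open import Data.List.Membership.Propositional using (_∈_; find)
import Data.List.Membership.Propositional.Properties as ∈
open import Data.List.Relation.Unary.All as All using (All)
import Data.List.Relation.Unary.All.Properties as All
open import Data.List.Relation.Unary.AllPairs using ([]; _∷_)
open import Data.List.Relation.Unary.Any using (here; there)
open import Data.List.Relation.Unary.Unique.Propositional using (Unique)
import Data.List.Relation.Unary.Unique.Propositional.Properties as Unique
open import Data.Nat as ℕ using (ℕ; zero; suc; NonZero; _∸_; _<_; _≤_; _≤ᵇ_; _≡ᵇ_; s≤s; z≤n)
open import Data.Nat.DivMod using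
  (_/_; _%_; m%n<n; m<n⇒m%n≡m; m<n⇒m/n≡0; [m+n]%n≡m%n; [m+kn]%n≡m%n; n%n≡0; %-distribˡ-+;
   m%n%n≡m%n; m≡m%n+[m/n]*n; +-distrib-/-∣ʳ; m*n/n≡m; m<n*o⇒m/o<n)
open import Data.Nat.Divisibility using (n∣m*n)
import Data.Nat.Properties as ℕ
import Data.Nat.Solver
open import Data.Product using (_×_; _,_; Σ; ∃; ∃₂; proj₁; proj₂)
open import Data.Rational as ℚ using (ℚ; 0ℚ; 1ℚ)
import Data.Rational.Properties as ℚ
open import Data.Rational.Solver using (module +-*-Solver)
import Data.Rational.Unnormalised as ℚᵘ
import Data.Rational.Unnormalised.Properties as ℚᵘ
open import Data.Unit using (tt)
open import Data.Vec as V using (Vec; map)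
import Data.Vec.Properties as V
open import Function using (_∘_; id; case_of_)
open import Function.Bundles using (_⇔_; mk⇔; Equivalence)
open import Level using (_⊔_)
open import Relation.Binary.Bundles using (Setoid)
import Relation.Binary.Reasoning.Setoid
open import Relation.Binary.PropositionalEquality using (_≡_; _≢_; refl; sym; trans; cong; cong₂; subst; module ≡-Reasoning)
open import Relation.Binary.Structures using (IsEquivalence)
open import Relation.Nullary using (¬_; ¬?; Dec; yes; no; does; contradiction)
open import Relation.Nullary.Decidable using (from-yes)
open import Relation.Unary using (Decidable)

-- Oddness of `t` enters twice. It confines the involutions of G to the three nonzero elements of
-- ℤ₂², and there ρ(g,g) is (-1) to the power b₁² + b₁b₂ + b₂², a form that is anisotropic over the
-- field with two elements. It also makes doubling surjective on ℤ_t, so that every sign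
-- homomorphism of G comes from ℤ₂². Since the last two elements of G carry no coboundary, `x` can
-- then be recovered from its matrix, and counting vectors is counting matrices.
--
-- Polynomials are unreduced lists of terms compared by coefficients. Their ring laws are proved by
-- testing against arbitrary linear functionals on monomials: the functional of a product is an
-- iterated functional, and each law follows from a law of exponents or of ℚ.
--
-- The Hadamard property is not decided directly. The solutions are selected by the finitely many
-- integer equations R(l+4) = 0, so a vector outside the list comes with an explicit generator that
-- does not vanish at it.

module FiniteSum {c ℓ} (M : CommutativeMonoid c ℓ) where
  open CommutativeMonoid M renaming (refl to ≈-refl; sym to ≈-sym; trans to ≈-trans)
  open Algebra.Properties.CommutativeSemigroup commutativeSemigroup using (interchange)

  private variable
    A B : Set

  sum : List A → (A → Carrier) → Carrier
  sum xs f = L.foldr (λ k acc → f k ∙ acc) ε xs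

  sum-cong : ∀ (xs : List A) {f g} → (∀ {k} → k ∈ xs → f k ≈ g k) → sum xs f ≈ sum xs g
  sum-cong []       _ = ≈-refl
  sum-cong (x ∷ xs) h = ∙-cong (h (here refl)) (sum-cong xs (h ∘ there))

  sum-ε : ∀ (xs : List A) {f} → (∀ {k} → k ∈ xs → f k ≈ ε) → sum xs f ≈ ε
  sum-ε []       _ = ≈-refl
  sum-ε (x ∷ xs) h = ≈-trans (∙-cong (h (here refl)) (sum-ε xs (h ∘ there))) (identityˡ ε)

  sum-∙ : ∀ (xs : List A) f g → sum xs (λ k → f k ∙ g k) ≈ sum xs f ∙ sum xs g
  sum-∙ []       f g = ≈-sym (identityˡ ε)
  sum-∙ (x ∷ xs) f g = ≈-trans (∙-congˡ (sum-∙ xs f g)) (interchange _ _ _ _)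

  sum-++ : ∀ (xs ys : List A) f → sum (xs L.++ ys) f ≈ sum xs f ∙ sum ys f
  sum-++ []       ys f = ≈-sym (identityˡ _)
  sum-++ (x ∷ xs) ys f = ≈-trans (∙-congˡ (sum-++ xs ys f)) (≈-sym (assoc _ _ _))

  sum-map : ∀ (h : A → B) xs f → sum (L.map h xs) f ≡ sum xs (f ∘ h)
  sum-map h xs f = L.foldr-map (λ k acc → f k ∙ acc) h ε xs

  -- Uniqueness of the list keeps the term at `i` from being counted twice. Serves Kronecker
  -- coefficients, the product of the δ_h at a point, and evaluation of a combination of indicators
  -- at a solution.
  sum-single : ∀ {xs : List A} {f} i → Unique xs → i ∈ xs →
               (∀ {k} → k ∈ xs → k ≢ i → f k ≈ ε) → sum xs f ≈ f i
  sum-single i (i∉xs ∷ _) (here refl) h = ≈-trans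
    (∙-congˡ (sum-ε _ λ k∈ → h (there k∈) λ { refl → All.lookup i∉xs k∈ refl })) (identityʳ _)
  sum-single i (x∉xs ∷ u) (there i∈) h = ≈-trans
    (∙-cong (h (here refl) (All.lookup x∉xs i∈)) (sum-single i u i∈ (h ∘ there))) (identityˡ _)

  sum-filter : ∀ {P : A → Set} (P? : Decidable P) xs {f} →
               (∀ k → ¬ P k → f k ≈ ε) → sum xs f ≈ sum (L.filter P? xs) f
  sum-filter P? []       h = ≈-refl
  sum-filter P? (x ∷ xs) h with P? x
  ... | yes p = ∙-congˡ (sum-filter P? xs h)
  ... | no ¬p = ≈-trans (∙-cong (h x ¬p) (sum-filter P? xs h)) (identityˡ _)

module LinearCombination {c ℓ} (R : CommutativeRing c ℓ) where
  open CommutativeRing R renaming (refl to ≈-refl; sym to ≈-sym; trans to ≈-trans)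
  open FiniteSum +-commutativeMonoid

  private variable
    A : Set

  *-distribˡ-sum : ∀ (xs : List A) q f → sum xs (λ k → q * f k) ≈ q * sum xs f
  *-distribˡ-sum []       q f = ≈-sym (zeroʳ q)
  *-distribˡ-sum (x ∷ xs) q f = ≈-trans (+-congˡ (*-distribˡ-sum xs q f)) (≈-sym (distribˡ q _ _))

  comb : List A → (A → Carrier) → (A → Carrier) → Carrier
  comb xs g a = sum xs (λ k → a k * g k)

  comb-+ : ∀ (xs : List A) g a b → comb xs g (λ k → a k + b k) ≈ comb xs g a + comb xs g b
  comb-+ xs g a b = ≈-trans (sum-cong xs λ _ → distribʳ _ _ _) (sum-∙ xs _ _)

  comb-* : ∀ (xs : List A) g q a → comb xs g (λ k → q * a k) ≈ q * comb xs g a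
  comb-* xs g q a = ≈-trans (sum-cong xs λ _ → *-assoc _ _ _) (*-distribˡ-sum xs q _)

  comb-0 : ∀ (xs : List A) g → comb xs g (λ _ → 0#) ≈ 0#
  comb-0 xs g = sum-ε xs λ _ → zeroˡ _

  comb-single : ∀ {xs : List A} g {a} i → Unique xs → i ∈ xs →
                a i ≈ 1# → (∀ {k} → k ≢ i → a k ≈ 0#) → comb xs g a ≈ g i
  comb-single g i u i∈ a₁ a₀ = ≈-trans
    (sum-single i u i∈ λ _ k≢i → ≈-trans (*-congʳ (a₀ k≢i)) (zeroˡ _))
    (≈-trans (*-congʳ a₁) (*-identityˡ _))

-- Polynomials as lists of terms: ring structure and evaluation

powℚ-+ : ∀ {N} q d e → powℚ {N} q (d ℕ.+ e) ≡ powℚ {N} q d ℚ.* powℚ {N} q e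
powℚ-+     q zero    e = sym (ℚ.*-identityˡ _)
powℚ-+ {N} q (suc d) e = trans (cong (q ℚ.*_) (powℚ-+ {N} q d e)) (sym (ℚ.*-assoc q _ _))

evalMono-⊕ : ∀ {N} (a : Vec ℚ N) m m′ →
             evalMono a (V.zipWith ℕ._+_ m m′) ≡ evalMono a m ℚ.* evalMono a m′
evalMono-⊕ V.[] V.[] V.[] = refl
evalMono-⊕ {suc N} (x V.∷ a) (d V.∷ m) (e V.∷ m′) = trans
  (cong₂ ℚ._*_ (powℚ-+ {N} x d e) (evalMono-⊕ a m m′))
  (solve 4 (λ p q r s → (p :* q) :* (r :* s) := (p :* r) :* (q :* s)) refl
    (powℚ {N} x d) (powℚ {N} x e) (evalMono a m) (evalMono a m′))
  where open +-*-Solver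

evalMono-0 : ∀ {N} (a : Vec ℚ N) → evalMono a (V.replicate N 0) ≡ 1ℚ
evalMono-0 V.[]      = refl
evalMono-0 (x V.∷ a) = trans (ℚ.*-identityˡ _) (evalMono-0 a)

module Polynomial {N : ℕ} where

  private variable
    p q u v : Poly N

  -- Linear extension of φ : Mono N → ℚ.  Evaluations and coefficients are instances.
  lin : (Mono N → ℚ) → Poly N → ℚ
  lin φ []            = 0ℚ
  lin φ ((c , m) ∷ p) = c ℚ.* φ m ℚ.+ lin φ p

  lin-++ : ∀ φ p q → lin φ (p L.++ q) ≡ lin φ p ℚ.+ lin φ q
  lin-++ φ []            q = sym (ℚ.+-identityˡ _)
  lin-++ φ ((c , m) ∷ p) q = trans (cong (c ℚ.* φ m ℚ.+_) (lin-++ φ p q)) (sym (ℚ.+-assoc (c ℚ.* φ m) (lin φ p) (lin φ q)))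

  lin-neg : ∀ φ p → lin φ (-ₚ p) ≡ ℚ.- lin φ p
  lin-neg φ []            = refl
  lin-neg φ ((c , m) ∷ p) = trans (cong (ℚ.- c ℚ.* φ m ℚ.+_) (lin-neg φ p))
    (solve 3 (λ c f l → :- c :* f :+ :- l := :- (c :* f :+ l)) refl c (φ m) (lin φ p))
    where open +-*-Solver

  lin-cong : ∀ {φ ψ} p → (∀ m → φ m ≡ ψ m) → lin φ p ≡ lin ψ p
  lin-cong []            h = refl
  lin-cong ((c , m) ∷ p) h = cong₂ (λ a b → c ℚ.* a ℚ.+ b) (h m) (lin-cong p h)

  lin-scale : ∀ c φ p → lin (λ m → c ℚ.* φ m) p ≡ c ℚ.* lin φ p
  lin-scale c φ []            = sym (ℚ.*-zeroʳ c)
  lin-scale c φ ((d , m) ∷ p) = trans (cong (d ℚ.* (c ℚ.* φ m) ℚ.+_) (lin-scale c φ p))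
    (solve 4 (λ c d f l → d :* (c :* f) :+ c :* l := c :* (d :* f :+ l)) refl c d (φ m) (lin φ p))
    where open +-*-Solver

  lin-+ : ∀ φ ψ p → lin (λ m → φ m ℚ.+ ψ m) p ≡ lin φ p ℚ.+ lin ψ p
  lin-+ φ ψ []            = refl
  lin-+ φ ψ ((c , m) ∷ p) = trans (cong (c ℚ.* (φ m ℚ.+ ψ m) ℚ.+_) (lin-+ φ ψ p))
    (solve 5 (λ c a b k l → c :* (a :+ b) :+ (k :+ l) := c :* a :+ k :+ (c :* b :+ l))
      refl c (φ m) (ψ m) (lin φ p) (lin ψ p))
    where open +-*-Solver

  lin-0 : ∀ p → lin (λ _ → 0ℚ) p ≡ 0ℚ
  lin-0 []            = refl
  lin-0 ((c , m) ∷ p) = trans (cong₂ ℚ._+_ (ℚ.*-zeroʳ c) (lin-0 p)) refl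

  -- Fubini for the two finite sums; this is what makes the product commutative.
  lin-swap : ∀ (φ : Mono N → Mono N → ℚ) p q →
             lin (λ m → lin (φ m) q) p ≡ lin (λ m′ → lin (λ m → φ m m′) p) q
  lin-swap φ []            q = sym (lin-0 q)
  lin-swap φ ((c , m) ∷ p) q = trans (cong₂ ℚ._+_ (sym (lin-scale c (φ m) q)) (lin-swap φ p q))
    (sym (lin-+ _ _ q))

  infixl 6 _⊕_
  _⊕_ : Mono N → Mono N → Mono N
  _⊕_ = V.zipWith ℕ._+_

  lin-term : ∀ φ c m q → lin φ (((c , m) ∷ []) *ₚ q) ≡ c ℚ.* lin (λ m′ → φ (m ⊕ m′)) q
  lin-term φ c m []             = sym (ℚ.*-zeroʳ c)
  lin-term φ c m ((d , m′) ∷ q) = trans (cong ((c ℚ.* d) ℚ.* φ (m ⊕ m′) ℚ.+_) (lin-term φ c m q))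
    (solve 4 (λ c d f l → (c :* d) :* f :+ c :* l := c :* (d :* f :+ l)) refl
       c d (φ (m ⊕ m′)) (lin (λ m′ → φ (m ⊕ m′)) q))
    where open +-*-Solver

  -- The two sides differ only by the trailing `[]` that `concatMap` leaves after a single term.
  term-*ₚ : ∀ c m (p q : Poly N) → ((c , m) ∷ p) *ₚ q ≡ ((c , m) ∷ []) *ₚ q L.++ p *ₚ q
  term-*ₚ c m p q = cong (L._++ p *ₚ q) (sym (L.++-identityʳ _))

  -- Reduces the laws of `*ₚ` to those of exponents: associativity becomes associativity of `⊕`
  -- under three nested functionals, commutativity becomes commutativity of `⊕` together with
  -- `lin-swap`.
  lin-* : ∀ φ p q → lin φ (p *ₚ q) ≡ lin (λ m → lin (λ m′ → φ (m ⊕ m′)) q) p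
  lin-* φ []            q = refl
  lin-* φ ((c , m) ∷ p) q = begin
    lin φ (((c , m) ∷ p) *ₚ q)                       ≡⟨ cong (lin φ) (term-*ₚ c m p q) ⟩
    lin φ (((c , m) ∷ []) *ₚ q L.++ p *ₚ q)           ≡⟨ lin-++ φ (((c , m) ∷ []) *ₚ q) (p *ₚ q) ⟩
    lin φ (((c , m) ∷ []) *ₚ q) ℚ.+ lin φ (p *ₚ q)    ≡⟨ cong₂ ℚ._+_ (lin-term φ c m q) (lin-* φ p q) ⟩
    _                                                ∎
    where open ≡-Reasoning

  -- Equality tested by all linear functionals.  As a record it lets p and q be inferred, which
  -- the unfolding relation _≈ₚ_ does not.
  infix 4 _≋_
  record _≋_ (p q : Poly N) : Set where
    constructor mk
    field lin-eq : ∀ φ → lin φ p ≡ lin φ q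
  open _≋_ public

  δ-mono : Mono N → Mono N → ℚ
  δ-mono m m′ = if does (V.≡-dec ℕ._≟_ m′ m) then 1ℚ else 0ℚ

  coeff-lin : ∀ p m → coeff p m ≡ lin (δ-mono m) p
  coeff-lin []             m = refl
  coeff-lin ((c , m′) ∷ p) m with does (V.≡-dec ℕ._≟_ m′ m)
  ... | true  = cong₂ ℚ._+_ (sym (ℚ.*-identityʳ c)) (coeff-lin p m)
  ... | false = trans (coeff-lin p m) (sym (trans (cong (ℚ._+ lin (δ-mono m) p) (ℚ.*-zeroʳ c)) (ℚ.+-identityˡ _)))

  ≋⇒≈ₚ : p ≋ q → p ≈ₚ q
  ≋⇒≈ₚ {p} {q} e m = trans (coeff-lin p m) (trans (lin-eq e (δ-mono m)) (sym (coeff-lin q m)))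

  remove : Mono N → Poly N → Poly N
  remove m = L.filter (λ x → ¬? (V.≡-dec ℕ._≟_ (proj₂ x) m))

  lin-remove : ∀ φ m p → lin φ p ≡ coeff p m ℚ.* φ m ℚ.+ lin φ (remove m p)
  lin-remove φ m []             = sym (trans (ℚ.+-identityʳ _) (ℚ.*-zeroˡ (φ m)))
  lin-remove φ m ((c , m′) ∷ p) with V.≡-dec ℕ._≟_ m′ m
  ... | yes refl = trans (cong (c ℚ.* φ m ℚ.+_) (lin-remove φ m p))
        (solve 4 (λ c f k l → c :* f :+ (k :* f :+ l) := (c :+ k) :* f :+ l) refl
          c (φ m) (coeff p m) (lin φ (remove m p)))
    where open +-*-Solver
  ... | no _     = trans (cong (c ℚ.* φ m′ ℚ.+_) (lin-remove φ m p))
        (solve 3 (λ a b l → a :+ (b :+ l) := b :+ (a :+ l)) refl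
          (c ℚ.* φ m′) (coeff p m ℚ.* φ m) (lin φ (remove m p)))
    where open +-*-Solver

  coeff-remove-≡ : ∀ m p → coeff (remove m p) m ≡ 0ℚ
  coeff-remove-≡ m []             = refl
  coeff-remove-≡ m ((c , m′) ∷ p) with V.≡-dec ℕ._≟_ m′ m in eq
  ... | yes _ = coeff-remove-≡ m p
  ... | no _ rewrite eq = coeff-remove-≡ m p

  coeff-remove : ∀ m p → p ≈ₚ [] → remove m p ≈ₚ []
  coeff-remove m p p≈0 m′ with V.≡-dec ℕ._≟_ m m′
  ... | yes refl = coeff-remove-≡ m p
  ... | no  m≢m′ = begin
    coeff (remove m p) m′                              ≡⟨ coeff-lin (remove m p) m′ ⟩
    lin φ (remove m p)                                 ≡⟨ ℚ.+-identityˡ _ ⟨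
    0ℚ ℚ.+ lin φ (remove m p)                          ≡⟨ cong (ℚ._+ lin φ (remove m p)) (ℚ.*-zeroˡ (φ m)) ⟨
    0ℚ ℚ.* φ m ℚ.+ lin φ (remove m p)                  ≡⟨ cong (λ z → z ℚ.* φ m ℚ.+ lin φ (remove m p)) (p≈0 m) ⟨
    coeff p m ℚ.* φ m ℚ.+ lin φ (remove m p)           ≡⟨ lin-remove φ m p ⟨
    lin φ p                                            ≡⟨ coeff-lin p m′ ⟨
    coeff p m′                                         ≡⟨ p≈0 m′ ⟩
    0ℚ                                                 ∎
    where
    open ≡-Reasoning
    φ = δ-mono m′

  -- Terms that cancel may be far apart in the list, so the induction strips all terms with the
  -- leading exponent at once; together they contribute `coeff p m ℚ.* φ m`, which is 0. What is
  -- left is shorter but not a structural part of `p`, hence the bound `n` on the length.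
  ≈ₚ0⇒lin≡0 : ∀ n p → L.length p ℕ.≤ n → p ≈ₚ [] → ∀ φ → lin φ p ≡ 0ℚ
  ≈ₚ0⇒lin≡0 _       []                _         p≈0 φ = refl
  ≈ₚ0⇒lin≡0 (suc n) p@((c , m) ∷ p′) (ℕ.s≤s l) p≈0 φ = begin
    lin φ p                                   ≡⟨ lin-remove φ m p ⟩
    coeff p m ℚ.* φ m ℚ.+ lin φ (remove m p)  ≡⟨ cong₂ (λ a b → a ℚ.* φ m ℚ.+ b) (p≈0 m) rest ⟩
    0ℚ ℚ.* φ m ℚ.+ 0ℚ                         ≡⟨ trans (ℚ.+-identityʳ _) (ℚ.*-zeroˡ (φ m)) ⟩
    0ℚ                                        ∎
    where
    open ≡-Reasoning
    shorter : L.length (remove m p) ℕ.≤ L.length p′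
    shorter with V.≡-dec ℕ._≟_ m m
    ... | yes _  = L.length-filter _ p′
    ... | no m≢m = contradiction refl m≢m
    rest = ≈ₚ0⇒lin≡0 n (remove m p) (ℕ.≤-trans shorter l) (coeff-remove m p p≈0) φ

  -- The difference `p -ₚ q` has zero coefficients, so every functional kills it. Ideal membership
  -- is certified coefficientwise; this turns a certificate into an equation that may be evaluated
  -- and computed with in the ring.
  ≈ₚ⇒≋ : p ≈ₚ q → p ≋ q
  ≈ₚ⇒≋ {p} {q} p≈q .lin-eq φ = begin
    lin φ p                              ≡⟨ solve 2 (λ a b → a := a :+ :- b :+ b) refl (lin φ p) (lin φ q) ⟩
    (lin φ p ℚ.- lin φ q) ℚ.+ lin φ q    ≡⟨ cong (ℚ._+ lin φ q) (lin-- φ) ⟨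
    lin φ (p -ₚ q) ℚ.+ lin φ q           ≡⟨ cong (ℚ._+ lin φ q) (≈ₚ0⇒lin≡0 _ (p -ₚ q) ℕ.≤-refl d≈0 φ) ⟩
    0ℚ ℚ.+ lin φ q                       ≡⟨ ℚ.+-identityˡ _ ⟩
    lin φ q                              ∎
    where
    open ≡-Reasoning
    open +-*-Solver
    lin-- : ∀ φ → lin φ (p -ₚ q) ≡ lin φ p ℚ.- lin φ q
    lin-- φ = trans (lin-++ φ p (-ₚ q)) (cong (lin φ p ℚ.+_) (lin-neg φ q))
    d≈0 : (p -ₚ q) ≈ₚ []
    d≈0 m = begin
      coeff (p -ₚ q) m                      ≡⟨ trans (coeff-lin (p -ₚ q) m) (lin-- (δ-mono m)) ⟩
      lin (δ-mono m) p ℚ.- lin (δ-mono m) q  ≡⟨ cong₂ ℚ._-_ (coeff-lin p m) (coeff-lin q m) ⟨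
      coeff p m ℚ.- coeff q m               ≡⟨ cong (ℚ._- coeff q m) (p≈q m) ⟩
      coeff q m ℚ.- coeff q m               ≡⟨ ℚ.+-inverseʳ (coeff q m) ⟩
      0ℚ                                    ∎

  ⊕-identityˡ : ∀ m → V.replicate N 0 ⊕ m ≡ m
  ⊕-identityˡ = V.zipWith-identityˡ ℕ.+-identityˡ

  lin-const* : ∀ φ c p → lin φ (constₚ c *ₚ p) ≡ c ℚ.* lin φ p
  lin-const* φ c p = trans (lin-term φ c _ p) (cong (c ℚ.*_) (lin-cong p λ m → cong φ (⊕-identityˡ m)))

  private
    *-cong : p ≋ q → u ≋ v → p *ₚ u ≋ q *ₚ v
    *-cong {p} {q} {u} {v} p≋q u≋v .lin-eq φ = begin
      lin φ (p *ₚ u)                              ≡⟨ lin-* φ p u ⟩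
      lin (λ m → lin (λ m′ → φ (m ⊕ m′)) u) p      ≡⟨ lin-cong p (λ m → lin-eq u≋v _) ⟩
      lin (λ m → lin (λ m′ → φ (m ⊕ m′)) v) p      ≡⟨ lin-eq p≋q _ ⟩
      lin (λ m → lin (λ m′ → φ (m ⊕ m′)) v) q      ≡⟨ lin-* φ q v ⟨
      lin φ (q *ₚ v)                              ∎
      where open ≡-Reasoning

    +-cong : p ≋ q → u ≋ v → p +ₚ u ≋ q +ₚ v
    +-cong {p} {q} {u} {v} p≋q u≋v .lin-eq φ = trans (lin-++ φ p u)
      (trans (cong₂ ℚ._+_ (lin-eq p≋q φ) (lin-eq u≋v φ)) (sym (lin-++ φ q v)))

    +-comm : ∀ (p q : Poly N) → p +ₚ q ≋ q +ₚ p
    +-comm p q .lin-eq φ = trans (lin-++ φ p q) (trans (ℚ.+-comm (lin φ p) (lin φ q)) (sym (lin-++ φ q p)))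

    -‿cong : p ≋ q → (-ₚ p) ≋ (-ₚ q)
    -‿cong {p} {q} e .lin-eq φ = trans (lin-neg φ p) (trans (cong ℚ.-_ (lin-eq e φ)) (sym (lin-neg φ q)))

    -‿inverseʳ : ∀ (p : Poly N) → p -ₚ p ≋ []
    -‿inverseʳ p .lin-eq φ = trans (lin-++ φ p (-ₚ p))
      (trans (cong (lin φ p ℚ.+_) (lin-neg φ p)) (ℚ.+-inverseʳ (lin φ p)))

    *-comm : ∀ (p q : Poly N) → p *ₚ q ≋ q *ₚ p
    *-comm p q .lin-eq φ = begin
      lin φ (p *ₚ q)                              ≡⟨ lin-* φ p q ⟩
      lin (λ m → lin (λ m′ → φ (m ⊕ m′)) q) p      ≡⟨ lin-swap _ p q ⟩
      lin (λ m′ → lin (λ m → φ (m ⊕ m′)) p) q      ≡⟨ lin-cong q (λ m′ → lin-cong p λ m → cong φ (V.zipWith-comm ℕ.+-comm m m′)) ⟩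
      lin (λ m′ → lin (λ m → φ (m′ ⊕ m)) p) q      ≡⟨ lin-* φ q p ⟨
      lin φ (q *ₚ p)                              ∎
      where open ≡-Reasoning

    *-assoc : ∀ (p q u : Poly N) → (p *ₚ q) *ₚ u ≋ p *ₚ (q *ₚ u)
    *-assoc p q u .lin-eq φ = begin
      lin φ ((p *ₚ q) *ₚ u)
        ≡⟨ trans (lin-* φ (p *ₚ q) u) (lin-* _ p q) ⟩
      lin (λ m → lin (λ m′ → lin (λ n → φ ((m ⊕ m′) ⊕ n)) u) q) p
        ≡⟨ lin-cong p (λ m → lin-cong q λ m′ → lin-cong u λ n → cong φ (V.zipWith-assoc ℕ.+-assoc m m′ n)) ⟩
      lin (λ m → lin (λ m′ → lin (λ n → φ (m ⊕ (m′ ⊕ n))) u) q) p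
        ≡⟨ trans (lin-* φ p (q *ₚ u)) (lin-cong p λ m → lin-* _ q u) ⟨
      lin φ (p *ₚ (q *ₚ u)) ∎
      where open ≡-Reasoning

    *-identityˡ : ∀ (p : Poly N) → constₚ 1ℚ *ₚ p ≋ p
    *-identityˡ p .lin-eq φ = trans (lin-const* φ 1ℚ p) (ℚ.*-identityˡ _)

    *-distribʳ : ∀ (p q u : Poly N) → (q +ₚ u) *ₚ p ≋ q *ₚ p +ₚ u *ₚ p
    *-distribʳ p q u .lin-eq φ = begin
      lin φ ((q +ₚ u) *ₚ p)                ≡⟨ trans (lin-* φ (q +ₚ u) p) (lin-++ _ q u) ⟩
      _                                    ≡⟨ cong₂ ℚ._+_ (lin-* φ q p) (lin-* φ u p) ⟨
      lin φ (q *ₚ p) ℚ.+ lin φ (u *ₚ p)    ≡⟨ lin-++ φ (q *ₚ p) (u *ₚ p) ⟨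
      lin φ (q *ₚ p +ₚ u *ₚ p)             ∎
      where open ≡-Reasoning

  ≋-ring : CommutativeRing _ _
  ≋-ring = record
    { Carrier = Poly N ; _≈_ = _≋_ ; _+_ = _+ₚ_ ; _*_ = _*ₚ_ ; -_ = -ₚ_ ; 0# = [] ; 1# = constₚ 1ℚ
    ; isCommutativeRing = record
      { isRing = record
        { +-isAbelianGroup = record
          { isGroup = record
            { isMonoid = record
              { isSemigroup = record
                { isMagma = record { isEquivalence = ≋-isEquivalence ; ∙-cong = +-cong }
                ; assoc = λ p q u → ≡⇒≋ (L.++-assoc p q u)
                }
              ; identity = (λ _ → mk λ _ → refl) , λ p → ≡⇒≋ (L.++-identityʳ p)
              }
            ; inverse = comm∧invʳ⇒inv ≋-setoid +-comm -‿inverseʳ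
            ; ⁻¹-cong = -‿cong
            }
          ; comm = +-comm
          }
        ; *-cong = *-cong
        ; *-assoc = *-assoc
        ; *-identity = comm∧idˡ⇒id ≋-setoid *-comm *-identityˡ
        ; distrib = comm∧distrʳ⇒distr ≋-setoid +-cong *-comm *-distribʳ
        }
      ; *-comm = *-comm
      }
    }
    where
    ≡⇒≋ : p ≡ q → p ≋ q
    ≡⇒≋ refl = mk λ _ → refl
    ≋-isEquivalence : IsEquivalence _≋_
    ≋-isEquivalence = record
      { refl  = mk λ _ → refl
      ; sym   = λ e → mk λ φ → sym (lin-eq e φ)
      ; trans = λ e f → mk λ φ → trans (lin-eq e φ) (lin-eq f φ)
      }
    ≋-setoid : Setoid _ _
    ≋-setoid = record { isEquivalence = ≋-isEquivalence }

  const-+ : ∀ c d → constₚ {N} (c ℚ.+ d) ≋ constₚ c +ₚ constₚ d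
  const-+ c d .lin-eq φ = solve 3 (λ c d f → (c :+ d) :* f :+ con 0ℚ := c :* f :+ (d :* f :+ con 0ℚ)) refl c d (φ (V.replicate N 0))
    where open +-*-Solver

  const-* : ∀ c d → constₚ {N} (c ℚ.* d) ≋ constₚ c *ₚ constₚ d
  const-* c d .lin-eq φ = sym (trans (lin-const* φ c (constₚ d))
    (solve 3 (λ c d f → c :* (d :* f :+ con 0ℚ) := (c :* d) :* f :+ con 0ℚ) refl c d (φ (V.replicate N 0))))
    where open +-*-Solver

  const-0 : constₚ {N} 0ℚ ≋ []
  const-0 .lin-eq φ = trans (ℚ.+-identityʳ _) (ℚ.*-zeroˡ (φ (V.replicate N 0)))

  term-≋ : ∀ c m → ((c , m) ∷ []) ≋ constₚ c *ₚ ((1ℚ , m) ∷ [])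
  term-≋ c m .lin-eq φ = sym (trans (lin-const* φ c ((1ℚ , m) ∷ []))
    (solve 2 (λ c f → c :* (con 1ℚ :* f :+ con 0ℚ) := c :* f :+ con 0ℚ) refl c (φ m)))
    where open +-*-Solver

  eval-lin : ∀ a p → evalₚ a p ≡ lin (evalMono a) p
  eval-lin a []            = refl
  eval-lin a ((c , m) ∷ p) = cong (c ℚ.* evalMono a m ℚ.+_) (eval-lin a p)

  eval-cong : ∀ a → p ≋ q → evalₚ a p ≡ evalₚ a q
  eval-cong {p} {q} a e = trans (eval-lin a p) (trans (lin-eq e _) (sym (eval-lin a q)))

  eval-+ : ∀ a p q → evalₚ a (p +ₚ q) ≡ evalₚ a p ℚ.+ evalₚ a q
  eval-+ a p q rewrite eval-lin a (p +ₚ q) | eval-lin a p | eval-lin a q = lin-++ _ p q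

  eval-neg : ∀ a p → evalₚ a (-ₚ p) ≡ ℚ.- evalₚ a p
  eval-neg a p rewrite eval-lin a (-ₚ p) | eval-lin a p = lin-neg _ p

  eval-- : ∀ a p q → evalₚ a (p -ₚ q) ≡ evalₚ a p ℚ.- evalₚ a q
  eval-- a p q = trans (eval-+ a p (-ₚ q)) (cong (evalₚ a p ℚ.+_) (eval-neg a q))

  eval-* : ∀ a p q → evalₚ a (p *ₚ q) ≡ evalₚ a p ℚ.* evalₚ a q
  eval-* a p q rewrite eval-lin a (p *ₚ q) | eval-lin a p | eval-lin a q = begin
    lin ev (p *ₚ q)                              ≡⟨ lin-* ev p q ⟩
    lin (λ m → lin (λ m′ → ev (m ⊕ m′)) q) p      ≡⟨ lin-cong p (λ m → trans (lin-cong q (evalMono-⊕ a m))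
                                                      (trans (lin-scale (ev m) ev q) (ℚ.*-comm (ev m) _))) ⟩
    lin (λ m → lin ev q ℚ.* ev m) p              ≡⟨ lin-scale (lin ev q) ev p ⟩
    lin ev q ℚ.* lin ev p                        ≡⟨ ℚ.*-comm (lin ev q) _ ⟩
    lin ev p ℚ.* lin ev q                        ∎
    where
    open ≡-Reasoning
    ev = evalMono a

  eval-const : ∀ (a : Vec ℚ N) c → evalₚ a (constₚ c) ≡ c
  eval-const a c = trans (ℚ.+-identityʳ _) (trans (cong (c ℚ.*_) (evalMono-0 a)) (ℚ.*-identityʳ c))

  eval-∑ : ∀ {A : Set} a (xs : List A) (f : A → Poly N) →
           evalₚ a (L.foldr (λ k acc → f k +ₚ acc) [] xs) ≡ FiniteSum.sum ℚ.+-0-commutativeMonoid xs (λ k → evalₚ a (f k))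
  eval-∑ a []       f = refl
  eval-∑ a (x ∷ xs) f = trans (eval-+ a (f x) (L.foldr (λ k acc → f k +ₚ acc) [] xs)) (cong (evalₚ a (f x) ℚ.+_) (eval-∑ a xs f))

-- Ideals and congruence modulo an ideal

module Ideals {c ℓ} (R : CommutativeRing c ℓ) where
  open CommutativeRing R renaming (refl to ≈-refl; sym to ≈-sym; trans to ≈-trans)
  open Algebra.Properties.Ring ring
  open Algebra.Properties.CommutativeSemigroup +-commutativeSemigroup using (interchange)

  record IsIdeal (I : Carrier → Set ℓ) : Set (c ⊔ ℓ) where
    field
      resp : ∀ {x y} → x ≈ y → I x → I y
      0∈   : I 0#
      +∈   : ∀ {x y} → I x → I y → I (x + y)
      *∈   : ∀ q {x} → I x → I (q * x)

    -∈ : ∀ {x} → I x → I (- x)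
    -∈ x∈ = resp (-1*x≈-x _) (*∈ (- 1#) x∈)

  module Congruence {I : Carrier → Set ℓ} (ideal : IsIdeal I) where
    open IsIdeal ideal

    infix 4 _~_
    -- With a stored difference `d` and `x ≈ y + d`, transitivity and addition of congruences just
    -- add the differences. The form `I (x - y)` that the quotient needs is recovered by `~⇒-∈`.
    record _~_ (x y : Carrier) : Set (c ⊔ ℓ) where
      constructor mk~
      field
        {diff}  : Carrier
        diff∈I  : I diff
        ≈y+diff : x ≈ y + diff

    ≈⇒~ : ∀ {x y} → x ≈ y → x ~ y
    ≈⇒~ e = mk~ 0∈ (≈-trans e (≈-sym (+-identityʳ _)))

    ~-refl : ∀ {x} → x ~ x
    ~-refl = ≈⇒~ ≈-refl

    ~-sym : ∀ {x y} → x ~ y → y ~ x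
    ~-sym {x} {y} (mk~ {d} d∈ e) = mk~ (-∈ d∈)
      (≈-sym (≈-trans (+-congʳ e) (≈-trans (+-assoc y d (- d)) (≈-trans (+-congˡ (-‿inverseʳ d)) (+-identityʳ y)))))

    ~-trans : ∀ {x y z} → x ~ y → y ~ z → x ~ z
    ~-trans (mk~ d∈ e) (mk~ d′∈ e′) = mk~ (+∈ d′∈ d∈) (≈-trans e (≈-trans (+-congʳ e′) (+-assoc _ _ _)))

    ~-+ : ∀ {x y u v} → x ~ y → u ~ v → x + u ~ y + v
    ~-+ (mk~ d∈ e) (mk~ d′∈ e′) = mk~ (+∈ d∈ d′∈) (≈-trans (+-cong e e′) (interchange _ _ _ _))

    ~-*ˡ : ∀ q {x y} → x ~ y → q * x ~ q * y
    ~-*ˡ q (mk~ d∈ e) = mk~ (*∈ q d∈) (≈-trans (*-congˡ e) (distribˡ q _ _))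

    ~-*ʳ : ∀ q {x y} → x ~ y → x * q ~ y * q
    ~-*ʳ q e = ~-trans (≈⇒~ (*-comm _ q)) (~-trans (~-*ˡ q e) (≈⇒~ (*-comm q _)))

    ~-setoid : Setoid c (c ⊔ ℓ)
    ~-setoid = record { Carrier = Carrier ; _≈_ = _~_ ; isEquivalence = record { refl = ~-refl ; sym = ~-sym ; trans = ~-trans } }

    ∈⇒~0 : ∀ {x} → I x → x ~ 0#
    ∈⇒~0 x∈ = mk~ x∈ (≈-sym (+-identityˡ _))

    ~⇒-∈ : ∀ {x y} → x ~ y → I (x - y)
    ~⇒-∈ {x} {y} (mk~ {d} d∈ e) = resp (≈-sym (≈-trans (+-congʳ (≈-trans e (+-comm y d)))
      (≈-trans (+-assoc d y (- y)) (≈-trans (+-congˡ (-‿inverseʳ y)) (+-identityʳ d))))) d∈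

    +-commutativeMonoid-~ : CommutativeMonoid c (c ⊔ ℓ)
    +-commutativeMonoid-~ = record
      { Carrier = Carrier ; _≈_ = _~_ ; _∙_ = _+_ ; ε = 0#
      ; isCommutativeMonoid = record
        { isMonoid = record
          { isSemigroup = record
            { isMagma = record { isEquivalence = Setoid.isEquivalence ~-setoid ; ∙-cong = ~-+ }
            ; assoc = λ x y z → ≈⇒~ (+-assoc x y z)
            }
          ; identity = (λ x → ≈⇒~ (+-identityˡ x)) , λ x → ≈⇒~ (+-identityʳ x)
          }
        ; comm = λ x y → ≈⇒~ (+-comm x y)
        }
      }

    -- The factor `1#` is kept on the right because it plays the role of an eigenvalue:
    -- multiplication by `x` acts on `x` as 1, and on `1# - x` as 0.
    x*x≡x-mod : ∀ {x} → I (x * x - x) → x * x ~ 1# * x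
    x*x≡x-mod {x} i = mk~ i (≈-sym (≈-trans (+-cong (*-identityˡ x) (+-comm _ _))
      (≈-trans (≈-sym (+-assoc _ _ _)) (≈-trans (+-congʳ (-‿inverseʳ x)) (+-identityˡ _)))))

    x*[1-x]≡0-mod : ∀ {x} → I (x * x - x) → x * (1# - x) ~ 0#
    x*[1-x]≡0-mod {x} i = ∈⇒~0 (resp (≈-sym (≈-trans (distribˡ x 1# (- x))
      (≈-trans (+-cong (*-identityʳ x) (≈-sym (-‿distribʳ-* x x)))
      (≈-trans (+-congʳ (≈-sym (-‿involutive x)))
      (≈-trans (-‿+-comm (- x) (x * x)) (-‿cong (+-comm _ _))))))) (-∈ i))

-- Interpolation on the Boolean cube

allVecs : ∀ n → List (Vec Bool n)
allVecs zero    = V.[] ∷ []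
allVecs (suc n) = L.map (true V.∷_) (allVecs n) L.++ L.map (false V.∷_) (allVecs n)

∈-allVecs : ∀ {n} (v : Vec Bool n) → v ∈ allVecs n
∈-allVecs V.[]          = here refl
∈-allVecs (true V.∷ v)  = ∈.∈-++⁺ˡ (∈.∈-map⁺ (true V.∷_) (∈-allVecs v))
∈-allVecs (false V.∷ v) = ∈.∈-++⁺ʳ (L.map (true V.∷_) (allVecs _)) (∈.∈-map⁺ (false V.∷_) (∈-allVecs v))

allVecs-unique : ∀ n → Unique (allVecs n)
allVecs-unique zero    = All.[] ∷ []
allVecs-unique (suc n) = Unique.++⁺
  (Unique.map⁺ V.∷-injectiveʳ (allVecs-unique n)) (Unique.map⁺ V.∷-injectiveʳ (allVecs-unique n))
  λ (p , q) → case (∈.∈-map⁻ (true V.∷_) p , ∈.∈-map⁻ (false V.∷_) q) of λ { ((_ , _ , refl) , (_ , _ , ())) }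

tabulate-const : ∀ {A : Set} n (x : A) → V.tabulate {n = n} (λ _ → x) ≡ V.replicate n x
tabulate-const zero    x = refl
tabulate-const (suc n) x = cong (x V.∷_) (tabulate-const n x)

unit : ∀ {n} → ℕ → Mono n
unit k = V.tabulate (λ i → if toℕ i ℕ.≡ᵇ k then 1 else 0)

unit-0 : ∀ {n} → unit {suc n} 0 ≡ 1 V.∷ V.replicate n 0
unit-0 = cong (1 V.∷_) (tabulate-const _ 0)

-- Every exponent vector is a sum of unit vectors, so a property of monomials may be proved by
-- multiplying with one variable at a time. This suits statements that are known only for the
-- variables themselves.
mono-induction : ∀ {n} (P : Mono n → Set) → P (V.replicate n 0) →
                 (∀ (i : Fin n) m → P m → P (V.zipWith ℕ._+_ (unit (toℕ i)) m)) → ∀ m → P m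
mono-induction P z s V.[] = z
mono-induction {suc n} P z s (e V.∷ m) = lead e
  where
  lead : ∀ e → P (e V.∷ m)
  lead zero    = mono-induction (λ m → P (0 V.∷ m)) z (λ i m → s (F.suc i) (0 V.∷ m)) m
  lead (suc e) = subst P (trans (cong (λ u → V.zipWith ℕ._+_ u (e V.∷ m)) unit-0)
    (cong (suc e V.∷_) (V.zipWith-identityˡ ℕ.+-identityˡ m))) (s F.zero (e V.∷ m) (lead e))

evalMono-unit : ∀ {n} (a : Vec ℚ n) i → evalMono a (unit (toℕ i)) ≡ V.lookup a i
evalMono-unit {suc n} (x V.∷ a) F.zero = begin
  evalMono (x V.∷ a) (unit 0)                      ≡⟨ cong (evalMono (x V.∷ a)) unit-0 ⟩
  (x ℚ.* 1ℚ) ℚ.* evalMono a (V.replicate n 0)      ≡⟨ cong₂ ℚ._*_ (ℚ.*-identityʳ x) (evalMono-0 a) ⟩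
  x ℚ.* 1ℚ                                         ≡⟨ ℚ.*-identityʳ x ⟩
  x                                                ∎
  where open ≡-Reasoning
evalMono-unit (x V.∷ a) (F.suc i) = trans (ℚ.*-identityˡ _) (evalMono-unit a i)

module Interpolation {N : ℕ} where
  open Polynomial {N}
  open CommutativeRing ≋-ring using
    (+-cong; *-cong; *-congˡ; *-congʳ; *-assoc; *-comm; *-identityˡ; *-identityʳ; zeroˡ; zeroʳ; distribʳ; setoid)
    renaming (trans to ≋-trans; sym to ≋-sym; refl to ≋-refl)
  open Ideals ≋-ring
  open FiniteSum (CommutativeRing.+-commutativeMonoid ≋-ring) using (sum; sum-++; sum-map)
  open LinearCombination ≋-ring using (*-distribˡ-sum)

  var : Fin N → Poly N
  var i = varₚ (suc (toℕ i))

  eval-var : ∀ a i → evalₚ a (var i) ≡ V.lookup a i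
  eval-var a i = trans (ℚ.+-identityʳ _) (trans (ℚ.*-identityˡ _) (evalMono-unit a i))

  literal : Bool → Poly N → Poly N
  literal true  x = x
  literal false x = constₚ 1ℚ -ₚ x

  -- The Lagrange polynomial of a point of the cube. The map `k` of positions lets the recursion
  -- drop a coordinate of the point without leaving the ring in `N` variables.
  indicator : ∀ {n} → (Fin n → Fin N) → Vec Bool n → Poly N
  indicator k V.[]      = constₚ 1ℚ
  indicator k (b V.∷ v) = literal b (var (k F.zero)) *ₚ indicator (k ∘ F.suc) v

  -- Expanding the product of the factors x_i + (1 - x_i) = 1 gives one indicator per vertex, so the
  -- identity holds in the polynomial ring itself, before any reduction modulo the ideal.
  ∑-indicator : ∀ {n} (k : Fin n → Fin N) → sum (allVecs n) (indicator k) ≋ constₚ 1ℚ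
  ∑-indicator {zero}  k = mk λ φ → refl
  ∑-indicator {suc n} k = begin
    sum (L.map (true V.∷_) vs L.++ L.map (false V.∷_) vs) (indicator k)
      ≈⟨ sum-++ (L.map (true V.∷_) vs) _ (indicator k) ⟩
    sum (L.map (true V.∷_) vs) (indicator k) +ₚ sum (L.map (false V.∷_) vs) (indicator k)
      ≡⟨ cong₂ _+ₚ_ (sum-map (true V.∷_) vs (indicator k)) (sum-map (false V.∷_) vs (indicator k)) ⟩
    sum vs (λ v → x *ₚ indicator k′ v) +ₚ sum vs (λ v → (constₚ 1ℚ -ₚ x) *ₚ indicator k′ v)
      ≈⟨ +-cong (*-distribˡ-sum vs x (indicator k′)) (*-distribˡ-sum vs (constₚ 1ℚ -ₚ x) (indicator k′)) ⟩
    x *ₚ Σ′ +ₚ (constₚ 1ℚ -ₚ x) *ₚ Σ′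
      ≈⟨ distribʳ Σ′ x (constₚ 1ℚ -ₚ x) ⟨
    (x +ₚ (constₚ 1ℚ -ₚ x)) *ₚ Σ′
      ≈⟨ *-cong (x+[1-x] x) (∑-indicator k′) ⟩
    constₚ 1ℚ *ₚ constₚ 1ℚ
      ≈⟨ *-identityˡ (constₚ 1ℚ) ⟩
    constₚ 1ℚ ∎
    where
    open Relation.Binary.Reasoning.Setoid setoid
    vs = allVecs n
    k′ = k ∘ F.suc
    x  = var (k F.zero)
    Σ′ = sum vs (indicator k′)
    x+[1-x] : ∀ y → y +ₚ (constₚ 1ℚ -ₚ y) ≋ constₚ 1ℚ
    x+[1-x] y .lin-eq φ rewrite lin-++ φ y (constₚ 1ℚ -ₚ y) | lin-++ φ (constₚ 1ℚ) (-ₚ y) | lin-neg φ y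
      = solve 2 (λ a b → a :+ (b :+ :- a) := b) refl (lin φ y) (lin φ (constₚ 1ℚ))
      where open +-*-Solver

  eval-literal : ∀ a i b c → V.lookup a i ≡ boolℚ c →
                 evalₚ a (literal b (var i)) ≡ (if does (b Bool.≟ c) then 1ℚ else 0ℚ)
  eval-literal a i true  false e = trans (eval-var a i) e
  eval-literal a i true  true  e = trans (eval-var a i) e
  eval-literal a i false c     e = trans (eval-- a (constₚ 1ℚ) (var i))
    (trans (cong₂ ℚ._-_ (eval-const a 1ℚ) (trans (eval-var a i) e)) (1-bool c))
    where
    1-bool : ∀ c → 1ℚ ℚ.- boolℚ c ≡ (if does (false Bool.≟ c) then 1ℚ else 0ℚ)
    1-bool false = refl
    1-bool true  = refl

  eval-indicator-≡ : ∀ {n} a (k : Fin n → Fin N) v → (∀ i → V.lookup a (k i) ≡ boolℚ (V.lookup v i)) →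
                     evalₚ a (indicator k v) ≡ 1ℚ
  eval-indicator-≡ a k V.[]      h = eval-const a 1ℚ
  eval-indicator-≡ a k (b V.∷ v) h = trans (eval-* a (literal b (var (k F.zero))) (indicator (k ∘ F.suc) v))
    (cong₂ ℚ._*_ (trans (eval-literal a _ b b (h F.zero)) (b≟b b)) (eval-indicator-≡ a (k ∘ F.suc) v (h ∘ F.suc)))
    where
    b≟b : ∀ b → (if does (b Bool.≟ b) then 1ℚ else 0ℚ) ≡ 1ℚ
    b≟b false = refl
    b≟b true  = refl

  eval-indicator-≢ : ∀ {n} a (k : Fin n → Fin N) v w → (∀ i → V.lookup a (k i) ≡ boolℚ (V.lookup w i)) →
                     v ≢ w → evalₚ a (indicator k v) ≡ 0ℚ
  eval-indicator-≢ a k V.[]      V.[]      h v≢w = contradiction refl v≢w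
  eval-indicator-≢ a k (b V.∷ v) (c V.∷ w) h v≢w =
    trans (eval-* a (literal b (var (k F.zero))) (indicator (k ∘ F.suc) v)) (factors b c v≢w (eval-literal a _ b c (h F.zero)))
    where
    rest = evalₚ a (indicator (k ∘ F.suc) v)
    tail-0 : ∀ q → v ≢ w → q ℚ.* rest ≡ 0ℚ
    tail-0 q ne = trans (cong (q ℚ.*_) (eval-indicator-≢ a (k ∘ F.suc) v w (h ∘ F.suc) ne)) (ℚ.*-zeroʳ q)
    factors : ∀ b c {q} → b V.∷ v ≢ c V.∷ w → q ≡ (if does (b Bool.≟ c) then 1ℚ else 0ℚ) → q ℚ.* rest ≡ 0ℚ
    factors true  true  {q} ne _ = tail-0 q (ne ∘ cong (true V.∷_))
    factors false false {q} ne _ = tail-0 q (ne ∘ cong (false V.∷_))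
    factors true  false ne e = trans (cong (ℚ._* rest) e) (ℚ.*-zeroˡ rest)
    factors false true  ne e = trans (cong (ℚ._* rest) e) (ℚ.*-zeroˡ rest)

  module _ {I : Poly N → Set} (ideal : IsIdeal I) (boolean : ∀ i → I (var i *ₚ var i -ₚ var i)) where
    open Congruence ideal
    open Relation.Binary.Reasoning.Setoid ~-setoid

    literal-eigen : ∀ b i → var i *ₚ literal b (var i) ~ constₚ (boolℚ b) *ₚ literal b (var i)
    literal-eigen true  i = x*x≡x-mod {var i} (boolean i)
    literal-eigen false i = ~-trans (x*[1-x]≡0-mod {var i} (boolean i))
      (≈⇒~ (≋-sym (≋-trans (*-congʳ {literal false (var i)} const-0) (zeroˡ (literal false (var i))))))

    indicator-var-eigen : ∀ {n} (k : Fin n → Fin N) v i →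
      var (k i) *ₚ indicator k v ~ constₚ (boolℚ (V.lookup v i)) *ₚ indicator k v
    indicator-var-eigen k (b V.∷ v) F.zero = begin
      x *ₚ (ℓ *ₚ L)     ≈⟨ ≈⇒~ (*-assoc x ℓ L) ⟨
      (x *ₚ ℓ) *ₚ L     ≈⟨ ~-*ʳ L (literal-eigen b (k F.zero)) ⟩
      (β *ₚ ℓ) *ₚ L     ≈⟨ ≈⇒~ (*-assoc β ℓ L) ⟩
      β *ₚ (ℓ *ₚ L)     ∎
      where
      x = var (k F.zero)
      ℓ = literal b x
      L = indicator (k ∘ F.suc) v
      β = constₚ (boolℚ b)
    indicator-var-eigen k (b V.∷ v) (F.suc i) = begin
      x *ₚ (ℓ *ₚ L)     ≈⟨ ≈⇒~ (swap x) ⟩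
      ℓ *ₚ (x *ₚ L)     ≈⟨ ~-*ˡ ℓ (indicator-var-eigen (k ∘ F.suc) v i) ⟩
      ℓ *ₚ (β *ₚ L)     ≈⟨ ≈⇒~ (swap β) ⟨
      β *ₚ (ℓ *ₚ L)     ∎
      where
      x = var (k (F.suc i))
      ℓ = literal b (var (k F.zero))
      L = indicator (k ∘ F.suc) v
      β = constₚ (boolℚ (V.lookup v i))
      swap : ∀ q → q *ₚ (ℓ *ₚ L) ≋ ℓ *ₚ (q *ₚ L)
      swap q = ≋-trans (≋-sym (*-assoc q ℓ L)) (≋-trans (*-congʳ (*-comm q ℓ)) (*-assoc ℓ q L))

    -- The indicator is a common eigenvector of multiplication by all variables, with eigenvalues
    -- the coordinates of `v`. Eigenvalues multiply along a monomial and add over terms, so `p` acts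
    -- by its value at `v`.
    indicator-eigen : ∀ v p → p *ₚ indicator id v ~ constₚ (evalₚ (V.map boolℚ v) p) *ₚ indicator id v
    indicator-eigen v = poly
      where
      E = indicator id v
      a = V.map boolℚ v
      mono : ∀ m → ((1ℚ , m) ∷ []) *ₚ E ~ constₚ (evalMono a m) *ₚ E
      mono = mono-induction _ (≈⇒~ (*-congʳ {E} (≡⇒≋ (cong constₚ (sym (evalMono-0 a)))))) step
        where
        ≡⇒≋ : ∀ {p q : Poly N} → p ≡ q → p ≋ q
        ≡⇒≋ refl = ≋-refl
        step : ∀ i m → ((1ℚ , m) ∷ []) *ₚ E ~ constₚ (evalMono a m) *ₚ E →
               ((1ℚ , unit (toℕ i) ⊕ m) ∷ []) *ₚ E ~ constₚ (evalMono a (unit (toℕ i) ⊕ m)) *ₚ E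
        step i m ih = begin
          (var i *ₚ x^m) *ₚ E        ≈⟨ ≈⇒~ (*-assoc (var i) x^m E) ⟩
          var i *ₚ (x^m *ₚ E)        ≈⟨ ~-*ˡ (var i) ih ⟩
          var i *ₚ (c *ₚ E)          ≈⟨ ≈⇒~ (≋-trans (≋-sym (*-assoc (var i) c E))
                                       (≋-trans (*-congʳ (*-comm (var i) c)) (*-assoc c (var i) E))) ⟩
          c *ₚ (var i *ₚ E)          ≈⟨ ~-*ˡ c (indicator-var-eigen id v i) ⟩
          c *ₚ (β *ₚ E)              ≈⟨ ≈⇒~ (*-assoc c β E) ⟨
          (c *ₚ β) *ₚ E              ≈⟨ ≈⇒~ (*-congʳ (const-* (evalMono a m) (boolℚ (V.lookup v i)))) ⟨
          constₚ (evalMono a m ℚ.* boolℚ (V.lookup v i)) *ₚ E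
            ≡⟨ cong (λ z → constₚ z *ₚ E) value ⟩
          constₚ (evalMono a (unit (toℕ i) ⊕ m)) *ₚ E ∎
          where
          x^m = (1ℚ , m) ∷ []
          c = constₚ (evalMono a m)
          β = constₚ (boolℚ (V.lookup v i))
          value : evalMono a m ℚ.* boolℚ (V.lookup v i) ≡ evalMono a (unit (toℕ i) ⊕ m)
          value = sym (trans (evalMono-⊕ a (unit (toℕ i)) m) (trans (ℚ.*-comm (evalMono a (unit (toℕ i))) _)
            (cong (evalMono a m ℚ.*_) (trans (evalMono-unit a i) (V.lookup-map i boolℚ v)))))
      poly : ∀ p → p *ₚ E ~ constₚ (evalₚ a p) *ₚ E
      poly [] = ≈⇒~ (≋-sym (≋-trans (*-congʳ const-0) (zeroˡ E)))
      poly ((c , m) ∷ p) = begin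
        ((c , m) ∷ p) *ₚ E                     ≡⟨ term-*ₚ c m p E ⟩
        ((c , m) ∷ []) *ₚ E +ₚ p *ₚ E          ≈⟨ ~-+ head (poly p) ⟩
        constₚ (c ℚ.* evalMono a m) *ₚ E +ₚ constₚ (evalₚ a p) *ₚ E
          ≈⟨ ≈⇒~ (distribʳ E (constₚ (c ℚ.* evalMono a m)) (constₚ (evalₚ a p))) ⟨
        (constₚ (c ℚ.* evalMono a m) +ₚ constₚ (evalₚ a p)) *ₚ E
          ≈⟨ ≈⇒~ (*-congʳ (const-+ (c ℚ.* evalMono a m) (evalₚ a p))) ⟨
        constₚ (evalₚ a ((c , m) ∷ p)) *ₚ E ∎
        where
        x^m = (1ℚ , m) ∷ []
        head : ((c , m) ∷ []) *ₚ E ~ constₚ (c ℚ.* evalMono a m) *ₚ E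
        head = begin
          ((c , m) ∷ []) *ₚ E                       ≈⟨ ≈⇒~ (*-congʳ (term-≋ c m)) ⟩
          (constₚ c *ₚ x^m) *ₚ E                    ≈⟨ ≈⇒~ (*-assoc (constₚ c) x^m E) ⟩
          constₚ c *ₚ (x^m *ₚ E)                    ≈⟨ ~-*ˡ (constₚ c) (mono m) ⟩
          constₚ c *ₚ (constₚ (evalMono a m) *ₚ E)  ≈⟨ ≈⇒~ (*-assoc (constₚ c) (constₚ (evalMono a m)) E) ⟨
          (constₚ c *ₚ constₚ (evalMono a m)) *ₚ E  ≈⟨ ≈⇒~ (*-congʳ (const-* c (evalMono a m))) ⟨
          constₚ (c ℚ.* evalMono a m) *ₚ E          ∎

    indicator-vanishes : ∀ v p → I p → evalₚ (V.map boolℚ v) p ≢ 0ℚ → indicator id v ~ []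
    indicator-vanishes v p p∈I p[v]≢0 = begin
      E                                   ≈⟨ ≈⇒~ (*-identityˡ E) ⟨
      constₚ 1ℚ *ₚ E                      ≡⟨ cong (λ z → constₚ z *ₚ E) (ℚ.*-inverseˡ q) ⟨
      constₚ (ℚ.1/ q ℚ.* q) *ₚ E          ≈⟨ ≈⇒~ (*-congʳ (const-* (ℚ.1/ q) q)) ⟩
      (constₚ (ℚ.1/ q) *ₚ constₚ q) *ₚ E  ≈⟨ ≈⇒~ (*-assoc (constₚ (ℚ.1/ q)) (constₚ q) E) ⟩
      constₚ (ℚ.1/ q) *ₚ (constₚ q *ₚ E)  ≈⟨ ~-*ˡ (constₚ (ℚ.1/ q)) (indicator-eigen v p) ⟨
      constₚ (ℚ.1/ q) *ₚ (p *ₚ E)         ≈⟨ ~-*ˡ (constₚ (ℚ.1/ q)) (~-*ʳ E (∈⇒~0 p∈I)) ⟩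
      constₚ (ℚ.1/ q) *ₚ []               ≈⟨ ≈⇒~ (zeroʳ (constₚ (ℚ.1/ q))) ⟩
      []                                  ∎
      where
      E = indicator id v
      q = evalₚ (V.map boolℚ v) p
      instance
        q≢0 : ℚ.NonZero q
        q≢0 = ℚ.≢-nonZero p[v]≢0

    interpolation : ∀ {P : Vec Bool N → Set} (P? : Decidable P) → (∀ v → ¬ P v → indicator id v ~ []) → ∀ p →
      p ~ sum (L.filter P? (allVecs N)) (λ v → constₚ (evalₚ (V.map boolℚ v) p) *ₚ indicator id v)
    interpolation P? vanish p = begin
      p                                                   ≈⟨ ≈⇒~ (*-identityʳ p) ⟨
      p *ₚ constₚ 1ℚ                                      ≈⟨ ≈⇒~ (*-congˡ {p} (∑-indicator id)) ⟨
      p *ₚ sum (allVecs N) (indicator id)                 ≈⟨ ≈⇒~ (*-distribˡ-sum (allVecs N) p (indicator id)) ⟨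
      sum (allVecs N) (λ v → p *ₚ indicator id v)
        ≈⟨ FiniteSum.sum-cong +-commutativeMonoid-~ (allVecs N) (λ {v} _ → indicator-eigen v p) ⟩
      sum (allVecs N) (λ v → coefficient v *ₚ indicator id v)
        ≈⟨ FiniteSum.sum-filter +-commutativeMonoid-~ P? (allVecs N)
             (λ v ¬Pv → ~-trans (~-*ˡ (coefficient v) (vanish v ¬Pv)) (≈⇒~ (zeroʳ (coefficient v)))) ⟩
      sum (L.filter P? (allVecs N)) (λ v → coefficient v *ₚ indicator id v) ∎
      where coefficient = λ v → constₚ (evalₚ (V.map boolℚ v) p)

-- Integer sums over the indices 1, ..., 4t and the group ℤ_t × ℤ₂²

∈-range⁺ : ∀ {lo hi k} → lo ≤ k → k ≤ hi → k ∈ range lo hi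
∈-range⁺ {lo} {hi} {k} lo≤k k≤hi = subst (_∈ range lo hi) (ℕ.m+[n∸m]≡n lo≤k)
  (∈.∈-map⁺ (lo ℕ.+_) (∈.∈-upTo⁺ (ℕ.≤-trans (s≤s (ℕ.∸-monoˡ-≤ lo k≤hi))
    (ℕ.≤-reflexive (sym (ℕ.+-∸-assoc 1 (ℕ.≤-trans lo≤k k≤hi)))))))

∈-range⁻ : ∀ {lo hi k} → k ∈ range lo hi → lo ≤ k × k ≤ hi
∈-range⁻ {lo} {hi} k∈ with i , i∈ , refl ← ∈.∈-map⁻ (lo ℕ.+_) k∈ =
  ℕ.m≤m+n lo i , ℕ.≤-pred (ℕ.≤-trans (ℕ.≤-reflexive (sym (ℕ.+-suc lo i)))
    (ℕ.≤-trans (ℕ.+-monoʳ-≤ lo i<) (ℕ.≤-reflexive (ℕ.m+[n∸m]≡n {lo} {suc hi}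
      -- The truncated difference `suc hi ∸ lo` exceeds `i`, so it is not 0 and the subtraction was
      -- exact.
      (ℕ.<⇒≤ (ℕ.m∸n≢0⇒n<m {suc hi} {lo} λ e → ℕ.n≮0 (subst (i <_) e i<)))))))
  where i< = ∈.∈-upTo⁻ i∈

range-unique : ∀ lo hi → Unique (range lo hi)
range-unique lo hi = Unique.map⁺ (ℕ.+-cancelˡ-≡ lo _ _) (Unique.upTo⁺ _)

≡ᵇ-refl : ∀ n → (n ≡ᵇ n) ≡ true
≡ᵇ-refl zero    = refl
≡ᵇ-refl (suc n) = ≡ᵇ-refl n

≢⇒≡ᵇ-false : ∀ {m n} → m ≢ n → (m ≡ᵇ n) ≡ false
≢⇒≡ᵇ-false {m} {n} m≢n with m ≡ᵇ n in eq
... | false = refl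
... | true  = contradiction (ℕ.≡ᵇ⇒≡ m n (subst T (sym eq) tt)) m≢n

open Algebra.Properties.Group (AbelianGroup.group ℤ.+-0-abelianGroup) using () renaming (∙-cancelˡ to +-cancelˡ)

module ℚΣ = FiniteSum ℚ.+-0-commutativeMonoid
module ℤΣ = FiniteSum ℤ.+-0-commutativeMonoid
open ℤΣ using (sum; sum-++; sum-map; sum-cong)
open LinearCombination ℤ.+-*-commutativeRing using (*-distribˡ-sum)

sum-upTo-suc : ∀ n G → sum (L.upTo (suc n)) G ≡ sum (L.upTo n) G ℤ.+ G n
sum-upTo-suc n G = begin
  sum (L.upTo (suc n)) G                  ≡⟨ cong (λ l → sum l G) (L.upTo-∷ʳ n) ⟨
  sum (L.upTo n L.++ n ∷ []) G            ≡⟨ sum-++ (L.upTo n) (n ∷ []) G ⟩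
  sum (L.upTo n) G ℤ.+ (G n ℤ.+ ℤ.+ 0)    ≡⟨ cong (ℤ._+_ (sum (L.upTo n) G)) (ℤ.+-identityʳ (G n)) ⟩
  sum (L.upTo n) G ℤ.+ G n                ∎
  where open ≡-Reasoning

sum-upTo-front : ∀ n G → sum (L.upTo (suc n)) G ≡ G 0 ℤ.+ sum (L.upTo n) (G ∘ suc)
sum-upTo-front n G = cong (ℤ._+_ (G 0)) (trans (cong (λ l → sum l G) (sym (L.map-upTo suc n))) (sum-map suc (L.upTo n) G))

-- The sum over one coset of ℤ₂², occupying four consecutive indices. The literal `+ 0` makes each
-- summand agree with `idx a b` by computation.
block : (ℕ → ℤ) → ℕ → ℤ
block G a = G (4 ℕ.* a ℕ.+ 0) ℤ.+ G (4 ℕ.* a ℕ.+ 1) ℤ.+ G (4 ℕ.* a ℕ.+ 2) ℤ.+ G (4 ℕ.* a ℕ.+ 3)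

sum-blocks : ∀ n G → sum (L.upTo (4 ℕ.* n)) G ≡
  sum (L.upTo n) (block G)
sum-blocks zero    G = refl
sum-blocks (suc n) G = begin
  sum (L.upTo (4 ℕ.* suc n)) G
    ≡⟨ cong (λ k → sum (L.upTo k) G) (ℕ.*-suc 4 n) ⟩
  sum (L.upTo (4 ℕ.+ 4 ℕ.* n)) G
    ≡⟨ trans (sum-upTo-suc (3 ℕ.+ m) G) (cong (ℤ._+ G (3 ℕ.+ m)) (trans (sum-upTo-suc (2 ℕ.+ m) G)
        (cong (ℤ._+ G (2 ℕ.+ m)) (trans (sum-upTo-suc (1 ℕ.+ m) G) (cong (ℤ._+ G (1 ℕ.+ m)) (sum-upTo-suc m G)))))) ⟩
  (((sum (L.upTo m) G ℤ.+ G m) ℤ.+ G (1 ℕ.+ m)) ℤ.+ G (2 ℕ.+ m)) ℤ.+ G (3 ℕ.+ m)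
    ≡⟨ cong₂ ℤ._+_ (cong₂ ℤ._+_ (cong₂ ℤ._+_ (cong₂ ℤ._+_ (sum-blocks n G) (comm 0)) (comm 1)) (comm 2)) (comm 3) ⟩
  (((Σ′ ℤ.+ G (m ℕ.+ 0)) ℤ.+ G (m ℕ.+ 1)) ℤ.+ G (m ℕ.+ 2)) ℤ.+ G (m ℕ.+ 3)
    ≡⟨ solve 5 (λ s a b c d → (((s :+ a) :+ b) :+ c) :+ d := s :+ (((a :+ b) :+ c) :+ d)) refl
         Σ′ (G (m ℕ.+ 0)) (G (m ℕ.+ 1)) (G (m ℕ.+ 2)) (G (m ℕ.+ 3)) ⟩
  Σ′ ℤ.+ block G n
    ≡⟨ sum-upTo-suc n (block G) ⟨
  sum (L.upTo (suc n)) (block G) ∎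
  where
  open ≡-Reasoning
  open Data.Integer.Solver.+-*-Solver
  m  = 4 ℕ.* n
  Σ′ = sum (L.upTo n) (block G)
  comm : ∀ k → G (k ℕ.+ m) ≡ G (m ℕ.+ k)
  comm k = cong G (ℕ.+-comm k m)

infixl 6 _⊞_

-- Addition of ℤ₂² with (b₁,b₂) numbered 2b₁ + b₂, that is, bitwise exclusive or. On a table over
-- `Fin 4` the group laws are decided by enumeration.
_⊞_ : Fin 4 → Fin 4 → Fin 4
0F ⊞ d  = d
1F ⊞ 0F = 1F
1F ⊞ 1F = 0F
1F ⊞ 2F = 3F
1F ⊞ 3F = 2F
2F ⊞ 0F = 2F
2F ⊞ 1F = 3F
2F ⊞ 2F = 0F
2F ⊞ 3F = 1F
3F ⊞ 0F = 3F
3F ⊞ 1F = 2F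
3F ⊞ 2F = 1F
3F ⊞ 3F = 0F

⊞-assoc : ∀ b c d → (b ⊞ c) ⊞ d ≡ b ⊞ (c ⊞ d)
⊞-assoc = from-yes (F.all? λ b → F.all? λ c → F.all? λ d → (b ⊞ c) ⊞ d F.≟ b ⊞ (c ⊞ d))

⊞-self : ∀ b → b ⊞ b ≡ 0F
⊞-self = from-yes (F.all? λ b → b ⊞ b F.≟ 0F)

⊞-identityʳ : ∀ b → b ⊞ 0F ≡ b
⊞-identityʳ = from-yes (F.all? λ b → b ⊞ 0F F.≟ b)

⊞-cancel : ∀ b c → (b ⊞ c) ⊞ c ≡ b
⊞-cancel b c = trans (⊞-assoc b c c) (trans (cong (b ⊞_) (⊞-self c)) (⊞-identityʳ b))

⊞-cancelˡ : ∀ b c → b ⊞ (b ⊞ c) ≡ c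
⊞-cancelˡ b c = trans (sym (⊞-assoc b b c)) (cong (_⊞ c) (⊞-self b))

toℕ-⊞ : ∀ b d → toℕ (b ⊞ d) ≡ 2 ℕ.* ((toℕ b / 2 ℕ.+ toℕ d / 2) % 2) ℕ.+ (toℕ b ℕ.+ toℕ d) % 2
toℕ-⊞ = from-yes (F.all? λ b → F.all? λ d → toℕ (b ⊞ d) ℕ.≟ 2 ℕ.* ((toℕ b / 2 ℕ.+ toℕ d / 2) % 2) ℕ.+ (toℕ b ℕ.+ toℕ d) % 2)

module Group (t : ℕ) .{{_ : NonZero t}} where

  -- A shift by `c` is `c` shifts by one, and a shift by one merely moves the first term of a
  -- t-periodic sequence to the end.
  sum-cyclic : ∀ c (G : ℕ → ℤ) → sum (L.upTo t) (λ a → G ((c ℕ.+ a) % t)) ≡ sum (L.upTo t) G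
  sum-cyclic zero    G = sum-cong (L.upTo t) λ k∈ → cong G (m<n⇒m%n≡m (∈.∈-upTo⁻ k∈))
  sum-cyclic (suc c) G = begin
    sum (L.upTo t) (λ a → G ((suc c ℕ.+ a) % t))
      ≡⟨ sum-cong (L.upTo t) (λ {a} _ → cong (λ z → G (z % t)) (sym (ℕ.+-suc c a))) ⟩
    sum (L.upTo t) (K ∘ suc)        ≡⟨ ∑-shift ⟩
    sum (L.upTo t) K                ≡⟨ sum-cyclic c G ⟩
    sum (L.upTo t) G                ∎
    where
    open ≡-Reasoning
    K = λ a → G ((c ℕ.+ a) % t)
    K-periodic : K t ≡ K 0
    K-periodic = cong G (trans ([m+n]%n≡m%n c t) (cong (_% t) (sym (ℕ.+-identityʳ c))))
    -- Both sums, once `K 0` is added, equal the sum of the first t + 1 terms, split at the front or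
    -- at the back.
    ∑-shift : sum (L.upTo t) (K ∘ suc) ≡ sum (L.upTo t) K
    ∑-shift = +-cancelˡ (K 0) _ _ (trans (sym (sum-upTo-front t K)) (trans (sum-upTo-suc t K)
      (trans (cong (ℤ._+_ (sum (L.upTo t) K)) K-periodic) (ℤ.+-comm _ (K 0)))))

  infixl 6 _⊕ᵗ_
  _⊕ᵗ_ : ℕ → ℕ → ℕ
  a ⊕ᵗ c = (a ℕ.+ c) % t

  χ : Fin 4 → Fin 4 → ℤ
  χ b d = h4 t (toℕ b) (toℕ d)

  χ-homˡ : ∀ b c d → χ (b ⊞ c) d ≡ χ b d ℤ.* χ c d
  χ-homˡ = from-yes (F.all? λ b → F.all? λ c → F.all? λ d → χ (b ⊞ c) d ℤ.≟ χ b d ℤ.* χ c d)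

  χ-homʳ : ∀ b c d → χ b (c ⊞ d) ≡ χ b c ℤ.* χ b d
  χ-homʳ = from-yes (F.all? λ b → F.all? λ c → F.all? λ d → χ b (c ⊞ d) ℤ.≟ χ b c ℤ.* χ b d)

  χ² : ∀ b d → χ b d ℤ.* χ b d ≡ ℤ.+ 1
  χ² = from-yes (F.all? λ b → F.all? λ d → χ b d ℤ.* χ b d ℤ.≟ ℤ.+ 1)

  -- Anisotropy of the quadratic form b₁² + b₁b₂ + b₂² over the field with two elements, the
  -- exponent of -1 in `χ b b`.
  χ-diagonal : ∀ b → b ≢ 0F → χ b b ≡ ℤ.- ℤ.+ 1
  χ-diagonal 0F b≢0 = contradiction refl b≢0
  χ-diagonal 1F _ = refl
  χ-diagonal 2F _ = refl
  χ-diagonal 3F _ = refl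

  idx : ℕ → Fin 4 → ℕ
  idx a b = suc (4 ℕ.* a ℕ.+ toℕ b)

  idx-≤ : ∀ {a} b → a < t → idx a b ≤ 4 ℕ.* t
  idx-≤ {a} b a<t = begin
    suc (4 ℕ.* a ℕ.+ toℕ b)   ≡⟨ ℕ.+-suc (4 ℕ.* a) (toℕ b) ⟨
    4 ℕ.* a ℕ.+ suc (toℕ b)   ≤⟨ ℕ.+-monoʳ-≤ (4 ℕ.* a) (F.toℕ<n b) ⟩
    4 ℕ.* a ℕ.+ 4             ≡⟨ trans (ℕ.+-comm (4 ℕ.* a) 4) (sym (ℕ.*-suc 4 a)) ⟩
    4 ℕ.* suc a               ≤⟨ ℕ.*-monoʳ-≤ 4 a<t ⟩
    4 ℕ.* t                   ∎
    where open ℕ.≤-Reasoning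

  idx-surjective : ∀ {i} → 1 ≤ i → i ≤ 4 ℕ.* t → ∃₂ λ a b → a < t × i ≡ idx a b
  idx-surjective {suc i} _ i<4t = i / 4 , F.fromℕ< (m%n<n i 4) ,
    m<n*o⇒m/o<n (subst (i <_) (ℕ.*-comm 4 t) i<4t) ,
    cong suc (trans (m≡m%n+[m/n]*n i 4) (trans (ℕ.+-comm (i % 4) _)
      (cong₂ ℕ._+_ (ℕ.*-comm (i / 4) 4) (sym (F.toℕ-fromℕ< (m%n<n i 4))))))

  idx-/ : ∀ a (b : Fin 4) → (4 ℕ.* a ℕ.+ toℕ b) / 4 ≡ a
  idx-/ a b = begin
    (4 ℕ.* a ℕ.+ toℕ b) / 4      ≡⟨ cong (_/ 4) (trans (ℕ.+-comm (4 ℕ.* a) (toℕ b)) (cong (toℕ b ℕ.+_) (ℕ.*-comm 4 a))) ⟩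
    (toℕ b ℕ.+ a ℕ.* 4) / 4      ≡⟨ +-distrib-/-∣ʳ (toℕ b) (n∣m*n a) ⟩
    toℕ b / 4 ℕ.+ a ℕ.* 4 / 4    ≡⟨ cong₂ ℕ._+_ (m<n⇒m/n≡0 (F.toℕ<n b)) (m*n/n≡m a 4) ⟩
    a                            ∎
    where open ≡-Reasoning

  idx-% : ∀ a (b : Fin 4) → (4 ℕ.* a ℕ.+ toℕ b) % 4 ≡ toℕ b
  idx-% a b = begin
    (4 ℕ.* a ℕ.+ toℕ b) % 4      ≡⟨ cong (_% 4) (trans (ℕ.+-comm (4 ℕ.* a) (toℕ b)) (cong (toℕ b ℕ.+_) (ℕ.*-comm 4 a))) ⟩
    (toℕ b ℕ.+ a ℕ.* 4) % 4      ≡⟨ [m+kn]%n≡m%n (toℕ b) a 4 ⟩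
    toℕ b % 4                    ≡⟨ m<n⇒m%n≡m (F.toℕ<n b) ⟩
    toℕ b                        ∎
    where open ≡-Reasoning

  r-idx : ∀ a b c d → r t (idx a b) (idx c d) ≡ χ b d
  r-idx a b c d = cong₂ (h4 t) (idx-% a b) (idx-% c d)

  jj-idx : ∀ a b c d → jj t (idx a b) (idx c d) ≡ idx (a ⊕ᵗ c) (b ⊞ d)
  jj-idx a b c d = begin
    jj t (idx a b) (idx c d)
      ≡⟨ cong₂ (λ x y → suc x ℕ.+ y) (cong₂ (λ x y → 4 ℕ.* x ℕ.+ 2 ℕ.* (y % 2))
           (cong₂ (λ x y → (x ℕ.+ y) % t) (idx-/ a b) (idx-/ c d))
           (cong₂ (λ x y → x / 2 ℕ.+ y / 2) (idx-% a b) (idx-% c d))) parity ⟩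
    suc (4 ℕ.* (a ⊕ᵗ c) ℕ.+ 2 ℕ.* u ℕ.+ v)
      ≡⟨ cong suc (trans (ℕ.+-assoc (4 ℕ.* (a ⊕ᵗ c)) (2 ℕ.* u) v) (cong (4 ℕ.* (a ⊕ᵗ c) ℕ.+_) (sym (toℕ-⊞ b d)))) ⟩
    idx (a ⊕ᵗ c) (b ⊞ d) ∎
    where
    open ≡-Reasoning
    u = (toℕ b / 2 ℕ.+ toℕ d / 2) % 2
    v = (toℕ b ℕ.+ toℕ d) % 2
    -- The two offsets of 1 in the indices add up to 2, so the parity of the 1-based indices is that
    -- of `b` and `d`.
    parity : (idx a b ℕ.+ idx c d) % 2 ≡ v
    parity = trans (cong (_% 2) (solve 4 (λ a b c d →
        con 1 :+ (con 4 :* a :+ b) :+ (con 1 :+ (con 4 :* c :+ d)) := b :+ d :+ (con 1 :+ con 2 :* a :+ con 2 :* c) :* con 2)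
        refl a (toℕ b) c (toℕ d)))
      ([m+kn]%n≡m%n (toℕ b ℕ.+ toℕ d) (1 ℕ.+ 2 ℕ.* a ℕ.+ 2 ℕ.* c) 2)
      where open Data.Nat.Solver.+-*-Solver

  ⊕ᵗ-%ˡ : ∀ a c → (a % t) ⊕ᵗ c ≡ a ⊕ᵗ c
  ⊕ᵗ-%ˡ a c = trans (%-distribˡ-+ (a % t) c t) (trans (cong (λ z → (z ℕ.+ c % t) % t) (m%n%n≡m%n a t)) (sym (%-distribˡ-+ a c t)))

  ⊕ᵗ-%ʳ : ∀ a c → a ⊕ᵗ (c % t) ≡ a ⊕ᵗ c
  ⊕ᵗ-%ʳ a c = trans (cong (_% t) (ℕ.+-comm a (c % t))) (trans (⊕ᵗ-%ˡ c a) (cong (_% t) (ℕ.+-comm c a)))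

  ⊕ᵗ-assoc : ∀ a c e → (a ⊕ᵗ c) ⊕ᵗ e ≡ a ⊕ᵗ (c ⊕ᵗ e)
  ⊕ᵗ-assoc a c e = trans (⊕ᵗ-%ˡ (a ℕ.+ c) e) (trans (cong (_% t) (ℕ.+-assoc a c e)) (sym (⊕ᵗ-%ʳ a (c ℕ.+ e))))

  -- The residue `(t ∸ c) % t` represents -c. Its reduction matters at `c = 0`, where `t ∸ c` is `t`
  -- itself.
  ∸-⊕ᵗ : ∀ {c} u → c < t → u < t → ((t ∸ c) % t) ⊕ᵗ (c ⊕ᵗ u) ≡ u
  ∸-⊕ᵗ {c} u c<t u<t = begin
    ((t ∸ c) % t) ⊕ᵗ (c ⊕ᵗ u)    ≡⟨ trans (⊕ᵗ-%ˡ (t ∸ c) (c ⊕ᵗ u)) (⊕ᵗ-%ʳ (t ∸ c) (c ℕ.+ u)) ⟩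
    (t ∸ c) ⊕ᵗ (c ℕ.+ u)         ≡⟨ cong (_% t) (trans (sym (ℕ.+-assoc (t ∸ c) c u))
                                      (trans (cong (ℕ._+ u) (ℕ.m∸n+n≡m (ℕ.<⇒≤ c<t))) (ℕ.+-comm t u))) ⟩
    (u ℕ.+ t) % t                ≡⟨ trans ([m+n]%n≡m%n u t) (m<n⇒m%n≡m u<t) ⟩
    u                            ∎
    where open ≡-Reasoning

  ∑-idx : ∀ F → ∑ℤ 1 (4 ℕ.* t) F ≡ sum (L.upTo t) (block (F ∘ suc))
  ∑-idx F = trans (sum-map suc (L.upTo (4 ℕ.* t)) F) (sum-blocks t (F ∘ suc))

  ∑-cong-idx : ∀ F G → (∀ {a} b → a < t → F (idx a b) ≡ G (idx a b)) → ∑ℤ 1 (4 ℕ.* t) F ≡ ∑ℤ 1 (4 ℕ.* t) G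
  ∑-cong-idx F G h = sum-cong (range 1 (4 ℕ.* t)) pointwise
    where
    pointwise : ∀ {k} → k ∈ range 1 (4 ℕ.* t) → F k ≡ G k
    pointwise k∈ with ∈-range⁻ k∈
    ... | 1≤k , k≤4t with a , b , a<t , refl ← idx-surjective 1≤k k≤4t = h b a<t

  -- Translation permutes G: the component in ℤ₂² reorders the four terms inside each coset, the
  -- component in ℤ_t rotates the cosets.
  ∑-translate : ∀ c d F → ∑ℤ 1 (4 ℕ.* t) (F ∘ jj t (idx c d)) ≡ ∑ℤ 1 (4 ℕ.* t) F
  ∑-translate c d F = begin
    ∑ℤ 1 (4 ℕ.* t) (F ∘ jj t (idx c d))              ≡⟨ ∑-idx (F ∘ jj t (idx c d)) ⟩
    sum (L.upTo t) (λ a → block (F ∘ jj t (idx c d) ∘ suc) a) ≡⟨ sum-cong (L.upTo t) (λ {a} _ → moved a) ⟩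
    sum (L.upTo t) (λ a → block (F ∘ suc) (c ⊕ᵗ a))            ≡⟨ sum-cyclic c (block (F ∘ suc)) ⟩
    sum (L.upTo t) (block (F ∘ suc))                         ≡⟨ ∑-idx F ⟨
    ∑ℤ 1 (4 ℕ.* t) F                                 ∎
    where
    open ≡-Reasoning
    permute : ∀ d (H : Fin 4 → ℤ) →
              H (d ⊞ 0F) ℤ.+ H (d ⊞ 1F) ℤ.+ H (d ⊞ 2F) ℤ.+ H (d ⊞ 3F) ≡ H 0F ℤ.+ H 1F ℤ.+ H 2F ℤ.+ H 3F
    permute 0F H = refl
    permute 1F H = solve 4 (λ w x y z → x :+ w :+ z :+ y := w :+ x :+ y :+ z) refl (H 0F) (H 1F) (H 2F) (H 3F)
      where open Data.Integer.Solver.+-*-Solver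
    permute 2F H = solve 4 (λ w x y z → y :+ z :+ w :+ x := w :+ x :+ y :+ z) refl (H 0F) (H 1F) (H 2F) (H 3F)
      where open Data.Integer.Solver.+-*-Solver
    permute 3F H = solve 4 (λ w x y z → z :+ y :+ x :+ w := w :+ x :+ y :+ z) refl (H 0F) (H 1F) (H 2F) (H 3F)
      where open Data.Integer.Solver.+-*-Solver
    at-idx : ∀ a b → F (jj t (idx c d) (idx a b)) ≡ F (idx (c ⊕ᵗ a) (d ⊞ b))
    at-idx a b = cong F (jj-idx c d a b)
    moved : ∀ a → block (F ∘ jj t (idx c d) ∘ suc) a ≡ block (F ∘ suc) (c ⊕ᵗ a)
    moved a = trans (cong₂ ℤ._+_ (cong₂ ℤ._+_ (cong₂ ℤ._+_ (at-idx a 0F) (at-idx a 1F)) (at-idx a 2F)) (at-idx a 3F))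
                    (permute d (λ b → F (idx (c ⊕ᵗ a) b)))

≤ᵇ-true : ∀ {m n} → m ≤ n → (m ≤ᵇ n) ≡ true
≤ᵇ-true m≤n = Bool.T-≡ .Equivalence.to (ℕ.≤⇒≤ᵇ m≤n)

at-lookup : ∀ {A : Set} {n} (v : Vec A n) d i → at v d (suc (toℕ i)) ≡ V.lookup v i
at-lookup (a V.∷ v) d F.zero    = refl
at-lookup (a V.∷ v) d (F.suc i) = at-lookup v d i

∑-one : ∀ n → sum (L.upTo n) (λ _ → ℤ.+ 1) ≡ ℤ.+ n
∑-one zero    = refl
∑-one (suc n) = trans (sum-upTo-suc n (λ _ → ℤ.+ 1)) (trans (cong (ℤ._+ ℤ.+ 1) (∑-one n)) (cong ℤ.+_ (ℕ.+-comm n 1)))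

-- Inner products of rows of the cocyclic matrix and the Hadamard criterion

module Cocycle (t : ℕ) .{{_ : NonZero t}} where
  open Group t

  inner : ℕ → Bool
  inner h = (2 ≤ᵇ h) ∧ (h ≤ᵇ (4 ℕ.* t ∸ 2))

  inner-true : ∀ {h} → 2 ≤ h × h ≤ 4 ℕ.* t ∸ 2 → inner h ≡ true
  inner-true (lo , hi) = cong₂ _∧_ (≤ᵇ-true lo) (≤ᵇ-true hi)

  -- The product of the δ_h with x_{h-1} = 1, so that ∏ ∂_h^{x_{h-1}} is the coboundary of f x.
  f : Vec Bool (nv t) → ℕ → ℤ
  f x h = if inner h then (if at x false (h ∸ 1) then ℤ.- ℤ.+ 1 else ℤ.+ 1) else ℤ.+ 1

  f² : ∀ x h → f x h ℤ.* f x h ≡ ℤ.+ 1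
  f² x h with inner h
  ... | false = refl
  ... | true with at x false (h ∸ 1)
  ...   | true  = refl
  ...   | false = refl

  -- Only the factor with `h = i` can differ from 1. If `i` lies outside the range there is no such
  -- factor, which is the default branch of `f`.
  ∏-δ : ∀ x i → ∏ℤ 2 (4 ℕ.* t ∸ 2) (λ h → if at x false (h ∸ 1) then δ t h i else ℤ.+ 1) ≡ f x i
  ∏-δ x i = by-cases (inner i) refl
    where
    open FiniteSum ℤ.*-1-commutativeMonoid using (sum-single; sum-ε)
    u : ℕ → ℤ
    u k = if at x false (k ∸ 1) then δ t k i else ℤ.+ 1
    trivial : ∀ {k} → k ≢ i → u k ≡ ℤ.+ 1
    trivial {k} k≢i with at x false (k ∸ 1)
    ... | false = refl
    ... | true rewrite ≢⇒≡ᵇ-false (k≢i ∘ sym) = refl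
    by-cases : ∀ b → inner i ≡ b → ∏ℤ 2 (4 ℕ.* t ∸ 2) u ≡
               (if b then (if at x false (i ∸ 1) then ℤ.- ℤ.+ 1 else ℤ.+ 1) else ℤ.+ 1)
    by-cases true eq = trans (sum-single {xs = range 2 (4 ℕ.* t ∸ 2)} {f = u} i (range-unique 2 (4 ℕ.* t ∸ 2))
        (∈-range⁺ (ℕ.≤ᵇ⇒≤ 2 i (proj₁ bounds)) (ℕ.≤ᵇ⇒≤ i _ (proj₂ bounds))) (λ _ → trivial))
      (cong (λ b → if at x false (i ∸ 1) then (if b then ℤ.- ℤ.+ 1 else ℤ.+ 1) else ℤ.+ 1) (≡ᵇ-refl i))
      where bounds = Bool.T-∧ .Equivalence.to (subst T (sym eq) tt)
    by-cases false eq = sum-ε (range 2 (4 ℕ.* t ∸ 2)) {u} λ k∈ →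
      trivial λ { refl → contradiction (trans (sym eq) (inner-true (∈-range⁻ k∈))) λ () }

  ψM-f : ∀ x i j → ψM t x i j ≡ r t i j ℤ.* (f x i ℤ.* f x j ℤ.* f x (jj t i j))
  ψM-f x i j = cong (r t i j ℤ.*_) (begin
    ∏ℤ 2 n (λ h → if at x false (h ∸ 1) then ∂ t h i j else ℤ.+ 1)
      ≡⟨ prod-cong (range 2 n) (λ {h} _ → split (at x false (h ∸ 1)) {δ t h i} {δ t h j}) ⟩
    ∏ℤ 2 n (λ h → u i h ℤ.* u j h ℤ.* u (jj t i j) h)
      ≡⟨ trans (prod-∙ (range 2 n) (λ h → u i h ℤ.* u j h) (u (jj t i j)))
               (cong (ℤ._* ∏ℤ 2 n (u (jj t i j))) (prod-∙ (range 2 n) (u i) (u j))) ⟩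
    ∏ℤ 2 n (u i) ℤ.* ∏ℤ 2 n (u j) ℤ.* ∏ℤ 2 n (u (jj t i j))
      ≡⟨ cong₂ ℤ._*_ (cong₂ ℤ._*_ (∏-δ x i) (∏-δ x j)) (∏-δ x (jj t i j)) ⟩
    f x i ℤ.* f x j ℤ.* f x (jj t i j) ∎)
    where
    open ≡-Reasoning
    open FiniteSum ℤ.*-1-commutativeMonoid renaming (sum-cong to prod-cong; sum-∙ to prod-∙) using ()
    n = 4 ℕ.* t ∸ 2
    u : ℕ → ℕ → ℤ
    u i h = if at x false (h ∸ 1) then δ t h i else ℤ.+ 1
    split : ∀ b {p q s} → (if b then p ℤ.* q ℤ.* s else ℤ.+ 1) ≡
      (if b then p else ℤ.+ 1) ℤ.* (if b then q else ℤ.+ 1) ℤ.* (if b then s else ℤ.+ 1)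
    split true  = refl
    split false = refl

  -- Up to sign, the sum of row g of M_ψ.
  R : Vec Bool (nv t) → ℕ → ℤ
  R x g = ∑ℤ 1 (4 ℕ.* t) (λ k → r t g k ℤ.* f x k ℤ.* f x (jj t g k))

  jj-assoc-idx : ∀ a b c d u v → jj t (idx a b) (jj t (idx c d) (idx u v)) ≡ jj t (jj t (idx a b) (idx c d)) (idx u v)
  jj-assoc-idx a b c d u v = begin
    jj t (idx a b) (jj t (idx c d) (idx u v))   ≡⟨ cong (jj t (idx a b)) (jj-idx c d u v) ⟩
    jj t (idx a b) (idx (c ⊕ᵗ u) (d ⊞ v))       ≡⟨ jj-idx a b (c ⊕ᵗ u) (d ⊞ v) ⟩
    idx (a ⊕ᵗ (c ⊕ᵗ u)) (b ⊞ (d ⊞ v))           ≡⟨ cong₂ idx (⊕ᵗ-assoc a c u) (⊞-assoc b d v) ⟨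
    idx ((a ⊕ᵗ c) ⊕ᵗ u) ((b ⊞ d) ⊞ v)           ≡⟨ jj-idx (a ⊕ᵗ c) (b ⊞ d) u v ⟨
    jj t (idx (a ⊕ᵗ c) (b ⊞ d)) (idx u v)       ≡⟨ cong (λ z → jj t z (idx u v)) (jj-idx a b c d) ⟨
    jj t (jj t (idx a b) (idx c d)) (idx u v)   ∎
    where open ≡-Reasoning

  open ≡-Reasoning

  -- Bilinearity gives ρ(g+j,k) ρ(j,k) = ρ(g,k) = ρ(g,j) ρ(g,j+k). Hence the summand at k is a fixed
  -- sign times the summand of R(g) at j+k, and translation by j absorbs the shift.
  row-product : ∀ x m e c d → let g = idx m e ; j = idx c d ; i = jj t g j in
    ∑ℤ 1 (4 ℕ.* t) (λ k → ψM t x i k ℤ.* ψM t x j k) ≡ (f x i ℤ.* f x j ℤ.* χ e d) ℤ.* R x g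
  row-product x m e c d = begin
    ∑ℤ 1 (4 ℕ.* t) (λ k → ψM t x i k ℤ.* ψM t x j k)
      ≡⟨ ∑-cong-idx (λ k → ψM t x i k ℤ.* ψM t x j k) (λ k → C ℤ.* F (jj t j k)) (λ {u} v _ → pointwise u v) ⟩
    ∑ℤ 1 (4 ℕ.* t) (λ k → C ℤ.* F (jj t j k))
      ≡⟨ *-distribˡ-sum (range 1 (4 ℕ.* t)) C (F ∘ jj t j) ⟩
    C ℤ.* ∑ℤ 1 (4 ℕ.* t) (F ∘ jj t j)
      ≡⟨ cong (C ℤ.*_) (∑-translate c d F) ⟩
    C ℤ.* R x g ∎
    where
    g = idx m e
    j = idx c d
    i = jj t g j
    C = f x i ℤ.* f x j ℤ.* χ e d
    F = λ k → r t g k ℤ.* f x k ℤ.* f x (jj t g k)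
    pointwise : ∀ u v → ψM t x i (idx u v) ℤ.* ψM t x j (idx u v) ≡ C ℤ.* F (jj t j (idx u v))
    pointwise u v = begin
      ψM t x i k ℤ.* ψM t x j k
        ≡⟨ cong₂ ℤ._*_ (ψM-f x i k) (ψM-f x j k) ⟩
      (r t i k ℤ.* (fi ℤ.* fk ℤ.* fik)) ℤ.* (r t j k ℤ.* (fj ℤ.* fk ℤ.* fjk))
        ≡⟨ cong₂ (λ p q → (p ℤ.* (fi ℤ.* fk ℤ.* fik)) ℤ.* (q ℤ.* (fj ℤ.* fk ℤ.* fjk)))
             (trans (cong (λ z → r t z k) (jj-idx m e c d)) (trans (r-idx (m ⊕ᵗ c) (e ⊞ d) u v) (χ-homˡ e d v))) (r-idx c d u v) ⟩
      ((hev ℤ.* hdv) ℤ.* (fi ℤ.* fk ℤ.* fik)) ℤ.* (hdv ℤ.* (fj ℤ.* fk ℤ.* fjk))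
        ≡⟨ solve 7 (λ hev hdv fi fj fk fik fjk → ((hev :* hdv) :* (fi :* fk :* fik)) :* (hdv :* (fj :* fk :* fjk))
             := (hdv :* hdv) :* (fk :* fk) :* (fi :* fj :* hev :* fik :* fjk)) refl hev hdv fi fj fk fik fjk ⟩
      (hdv ℤ.* hdv) ℤ.* (fk ℤ.* fk) ℤ.* Z
        -- The square of ρ(j,k) is exchanged for that of ρ(g,j), also 1: one copy goes into `C`, the
        -- other turns ρ(g,k) into ρ(g,j+k).
        ≡⟨ cong₂ (λ p q → p ℤ.* q ℤ.* Z) (trans (χ² d v) (sym (χ² e d))) (f² x k) ⟩
      (hed ℤ.* hed) ℤ.* ℤ.+ 1 ℤ.* Z
        ≡⟨ solve 6 (λ hed hev fi fj fik fjk → (hed :* hed) :* con (ℤ.+ 1) :* (fi :* fj :* hev :* fik :* fjk)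
             := (fi :* fj :* hed) :* ((hed :* hev) :* fjk :* fik)) refl hed hev fi fj fik fjk ⟩
      C ℤ.* ((hed ℤ.* hev) ℤ.* fjk ℤ.* fik)
        ≡⟨ cong₂ (λ p q → C ℤ.* (p ℤ.* fjk ℤ.* f x q))
             (sym (trans (cong (r t g) (jj-idx c d u v)) (trans (r-idx m e (c ⊕ᵗ u) (d ⊞ v)) (χ-homʳ e d v))))
             (sym (jj-assoc-idx m e c d u v)) ⟩
      C ℤ.* F (jj t j k) ∎
      where
      open Data.Integer.Solver.+-*-Solver
      k = idx u v
      fi = f x i
      fj = f x j
      fk = f x k
      fik = f x (jj t i k)
      fjk = f x (jj t j k)
      hev = χ e v
      hdv = χ d v
      hed = χ e d
      Z = fi ℤ.* fj ℤ.* hev ℤ.* fik ℤ.* fjk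

  -- The elements -g and g have the same component in ℤ₂², so ρ(-g,g+k) = ρ(g,g) ρ(g,k); the two
  -- values of `f` change places because -g + (g+k) = k.
  R-neg : ∀ x {c} d → c < t → R x (idx ((t ∸ c) % t) d) ≡ χ d d ℤ.* R x (idx c d)
  R-neg x {c} d c<t = begin
    R x g′                                             ≡⟨ ∑-translate c d F′ ⟨
    ∑ℤ 1 (4 ℕ.* t) (F′ ∘ jj t g)
      ≡⟨ ∑-cong-idx (F′ ∘ jj t g) (λ k → χ d d ℤ.* F k) (λ {u} v u<t → pointwise u v u<t) ⟩
    ∑ℤ 1 (4 ℕ.* t) (λ k → χ d d ℤ.* F k)             ≡⟨ *-distribˡ-sum (range 1 (4 ℕ.* t)) (χ d d) F ⟩
    χ d d ℤ.* R x g                                  ∎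
    where
    g  = idx c d
    g′ = idx ((t ∸ c) % t) d
    F  = λ k → r t g k ℤ.* f x k ℤ.* f x (jj t g k)
    F′ = λ k → r t g′ k ℤ.* f x k ℤ.* f x (jj t g′ k)
    pointwise : ∀ u v → u < t → F′ (jj t g (idx u v)) ≡ χ d d ℤ.* F (idx u v)
    pointwise u v u<t = begin
      r t g′ (jj t g k) ℤ.* f x (jj t g k) ℤ.* f x (jj t g′ (jj t g k))
        ≡⟨ cong₂ (λ p q → p ℤ.* f x (jj t g k) ℤ.* f x q) r-value back ⟩
      (χ d d ℤ.* r t g k) ℤ.* f x (jj t g k) ℤ.* f x k
        ≡⟨ solve 4 (λ a b p q → (a :* b) :* p :* q := a :* (b :* q :* p)) refl (χ d d) (r t g k) (f x (jj t g k)) (f x k) ⟩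
      χ d d ℤ.* F k ∎
      where
      open Data.Integer.Solver.+-*-Solver
      k = idx u v
      r-value : r t g′ (jj t g k) ≡ χ d d ℤ.* r t g k
      r-value = trans (cong (r t g′) (jj-idx c d u v)) (trans (r-idx ((t ∸ c) % t) d (c ⊕ᵗ u) (d ⊞ v))
        (trans (χ-homʳ d d v) (cong (χ d d ℤ.*_) (sym (r-idx c d u v)))))
      back : jj t g′ (jj t g k) ≡ k
      back = trans (cong (jj t g′) (jj-idx c d u v)) (trans (jj-idx ((t ∸ c) % t) d (c ⊕ᵗ u) (d ⊞ v))
        (cong₂ idx (∸-⊕ᵗ u c<t u<t) (⊞-cancelˡ d v)))

  -- Involutions are the rows with g⁻¹ = g and ψ(g,g) = -1.
  R-involution : ∀ x d → 0 < t → d ≢ 0F → R x (idx 0 d) ≡ ℤ.+ 0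
  R-involution x d 0<t d≢0 = z≡-z⇒z≡0 _ (begin
    R x (idx 0 d)               ≡⟨ cong (λ z → R x (idx z d)) (n%n≡0 t) ⟨
    R x (idx (t % t) d)         ≡⟨ R-neg x d 0<t ⟩
    χ d d ℤ.* R x (idx 0 d)   ≡⟨ cong (ℤ._* R x (idx 0 d)) (χ-diagonal d d≢0) ⟩
    ℤ.- ℤ.+ 1 ℤ.* R x (idx 0 d) ≡⟨ ℤ.-1*i≡-i _ ⟩
    ℤ.- R x (idx 0 d)           ∎)
    where
    z≡-z⇒z≡0 : ∀ z → z ≡ ℤ.- z → z ≡ ℤ.+ 0
    z≡-z⇒z≡0 (ℤ.+ zero) _ = refl
    z≡-z⇒z≡0 (ℤ.+ suc _) ()
    z≡-z⇒z≡0 (ℤ.-[1+ _ ]) ()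

  ψM² : ∀ x a b c d → ψM t x (idx a b) (idx c d) ℤ.* ψM t x (idx a b) (idx c d) ≡ ℤ.+ 1
  ψM² x a b c d = trans (cong₂ ℤ._*_ e e)
    (trans (solve 4 (λ h p q s → (h :* (p :* q :* s)) :* (h :* (p :* q :* s))
       := (h :* h) :* (p :* p) :* (q :* q) :* (s :* s)) refl
      (χ b d) (f x i) (f x j) (f x (jj t i j)))
    (cong₂ ℤ._*_ (cong₂ ℤ._*_ (cong₂ ℤ._*_ (χ² b d) (f² x i)) (f² x j)) (f² x (jj t i j))))
    where
    open Data.Integer.Solver.+-*-Solver
    i = idx a b
    j = idx c d
    e = trans (ψM-f x i j) (cong (ℤ._* (f x i ℤ.* f x j ℤ.* f x (jj t i j))) (r-idx a b c d))

  module OddOrder (t-odd : t % 2 ≡ 1) where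

    half : ℕ
    half = t / 2

    t≡1+2half : t ≡ 1 ℕ.+ half ℕ.* 2
    t≡1+2half = trans (m≡m%n+[m/n]*n t 2) (cong (ℕ._+ half ℕ.* 2) t-odd)

    0<t : 0 < t
    0<t = subst (0 <_) (sym t≡1+2half) (s≤s z≤n)

    2t∸2≡4half : 2 ℕ.* t ∸ 2 ≡ 4 ℕ.* half
    2t∸2≡4half = trans (cong (λ z → 2 ℕ.* z ∸ 2) t≡1+2half) (cong (_∸ 2)
      (solve 1 (λ h → con 2 :* (con 1 :+ h :* con 2) := con 2 :+ con 4 :* h) refl half))
      where open Data.Nat.Solver.+-*-Solver

    RowsBalanced : Vec Bool (nv t) → Set
    RowsBalanced x = ∀ {l} → 1 ≤ l → l ≤ 2 ℕ.* t ∸ 2 → R x (l ℕ.+ 4) ≡ ℤ.+ 0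

    R-low : ∀ x → RowsBalanced x → ∀ m e → 1 ≤ m → m ≤ half → R x (idx m e) ≡ ℤ.+ 0
    R-low x bal (suc m) e _ m<half = trans (cong (R x) (sym l+4)) (bal (s≤s z≤n) l≤)
      where
      -- The shift by 4 in the generators skips the first block, which is the subgroup ℤ₂².
      l = suc (4 ℕ.* m ℕ.+ toℕ e)
      l+4 : l ℕ.+ 4 ≡ idx (suc m) e
      l+4 = solve 2 (λ m e → con 1 :+ (con 4 :* m :+ e) :+ con 4 := con 1 :+ (con 4 :* (con 1 :+ m) :+ e)) refl m (toℕ e)
        where open Data.Nat.Solver.+-*-Solver
      l≤ : l ≤ 2 ℕ.* t ∸ 2
      l≤ = ≤.begin
        suc (4 ℕ.* m ℕ.+ toℕ e)    ≤.≡⟨ ℕ.+-suc (4 ℕ.* m) (toℕ e) ⟨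
        4 ℕ.* m ℕ.+ suc (toℕ e)    ≤.≤⟨ ℕ.+-monoʳ-≤ (4 ℕ.* m) (F.toℕ<n e) ⟩
        4 ℕ.* m ℕ.+ 4              ≤.≡⟨ trans (ℕ.+-comm (4 ℕ.* m) 4) (sym (ℕ.*-suc 4 m)) ⟩
        4 ℕ.* suc m                ≤.≤⟨ ℕ.*-monoʳ-≤ 4 m<half ⟩
        4 ℕ.* half                 ≤.≡⟨ 2t∸2≡4half ⟨
        2 ℕ.* t ∸ 2                ≤.∎
        where module ≤ = ℕ.≤-Reasoning

    -- Rows 5, …, 2t+2 are those with first coordinate 1, …, (t-1)/2; the other rows outside
    -- the Klein four-group are their negatives.
    R-nonzero : ∀ x → RowsBalanced x → ∀ {m} e → m < t → (m ≡ 0 → e ≢ 0F) → R x (idx m e) ≡ ℤ.+ 0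
    R-nonzero x bal {zero}  e m<t ne = R-involution x e 0<t (ne refl)
    R-nonzero x bal {suc m} e m<t ne with suc m ℕ.≤? half
    ... | yes m≤half = R-low x bal (suc m) e (s≤s z≤n) m≤half
    ... | no  m≰half = begin
      R x (idx (suc m) e)              ≡⟨ cong (λ z → R x (idx z e)) m≡ ⟨
      R x (idx ((t ∸ m′) % t) e)       ≡⟨ R-neg x e m′<t ⟩
      χ e e ℤ.* R x (idx m′ e)       ≡⟨ cong (χ e e ℤ.*_) (R-low x bal m′ e 1≤m′ m′≤half) ⟩
      χ e e ℤ.* ℤ.+ 0                  ≡⟨ ℤ.*-zeroʳ (χ e e) ⟩
      ℤ.+ 0                              ∎
      where
      m′ = t ∸ suc m
      1≤m′ : 1 ≤ m′
      1≤m′ = ℕ.m<n⇒0<n∸m m<t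
      m′<t : m′ < t
      m′<t = ℕ.∸-monoʳ-< (s≤s z≤n) (ℕ.<⇒≤ m<t)
      m≡ : (t ∸ m′) % t ≡ suc m
      m≡ = trans (cong (_% t) (ℕ.m∸[m∸n]≡n (ℕ.<⇒≤ m<t))) (m<n⇒m%n≡m m<t)
      m′≤half : m′ ≤ half
      m′≤half = ℕ.≤-trans (ℕ.∸-monoʳ-≤ t (ℕ.≰⇒> m≰half)) (ℕ.≤-reflexive (trans (cong (_∸ suc half) t≡1+2half)
        (trans (cong (_∸ half) (trans (ℕ.*-comm half 2) (cong (half ℕ.+_) (ℕ.+-identityʳ half)))) (ℕ.m+n∸m≡n half half))))

    -- Writes row i as g + j with g = i - j, which is the shape `row-product` expects. Elements of
    -- ℤ₂² are their own negatives, so `b ⊞ d` is the difference there.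
    jj-difference : ∀ {a} b {c} d → a < t → c < t → jj t (idx ((a ℕ.+ (t ∸ c)) % t) (b ⊞ d)) (idx c d) ≡ idx a b
    jj-difference {a} b {c} d a<t c<t = trans (jj-idx ((a ℕ.+ (t ∸ c)) % t) (b ⊞ d) c d) (cong₂ (idx)
      (trans (⊕ᵗ-%ˡ (a ℕ.+ (t ∸ c)) c) (trans (cong (_% t) (trans (ℕ.+-assoc a (t ∸ c) c) (cong (a ℕ.+_) (ℕ.m∸n+n≡m (ℕ.<⇒≤ c<t)))))
        (trans ([m+n]%n≡m%n a t) (m<n⇒m%n≡m a<t))))
      (⊞-cancel b d))

    jj-identityˡ : ∀ {c} d → c < t → jj t (idx 0 0F) (idx c d) ≡ idx c d
    jj-identityˡ {c} d c<t = trans (jj-idx 0 0F c d) (cong (λ z → idx z d) (m<n⇒m%n≡m c<t))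

    row-norm : ∀ x a b → ∑ℤ 1 (4 ℕ.* t) (λ k → ψM t x (idx a b) k ℤ.* ψM t x (idx a b) k) ≡ ℤ.+ (4 ℕ.* t)
    row-norm x a b = begin
      ∑ℤ 1 (4 ℕ.* t) (λ k → ψM t x (idx a b) k ℤ.* ψM t x (idx a b) k)
        ≡⟨ ∑-cong-idx (λ k → ψM t x (idx a b) k ℤ.* ψM t x (idx a b) k) (λ _ → ℤ.+ 1) (λ {u} v _ → ψM² x a b u v) ⟩
      ∑ℤ 1 (4 ℕ.* t) (λ _ → ℤ.+ 1)                       ≡⟨ sum-map suc (L.upTo (4 ℕ.* t)) (λ _ → ℤ.+ 1) ⟩
      sum (L.upTo (4 ℕ.* t)) (λ _ → ℤ.+ 1)               ≡⟨ ∑-one (4 ℕ.* t) ⟩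
      ℤ.+ (4 ℕ.* t)                                      ∎

    row-orthogonal : ∀ x → RowsBalanced x → ∀ {m} e c d → m < t → (m ≡ 0 → e ≢ 0F) →
      ∑ℤ 1 (4 ℕ.* t) (λ k → ψM t x (jj t (idx m e) (idx c d)) k ℤ.* ψM t x (idx c d) k) ≡ ℤ.+ 0
    row-orthogonal x bal {m} e c d m<t g≢1 = trans (row-product x m e c d)
      (trans (cong (C ℤ.*_) (R-nonzero x bal e m<t g≢1)) (ℤ.*-zeroʳ C))
      where C = f x (jj t (idx m e) (idx c d)) ℤ.* f x (idx c d) ℤ.* χ e d

    balanced⇒hadamard : ∀ x → RowsBalanced x → IsHadamard (4 ℕ.* t) (ψM t x)
    balanced⇒hadamard x bal i j 1≤i i≤ 1≤j j≤ = by-cases (idx-surjective 1≤i i≤) (idx-surjective 1≤j j≤) (i ℕ.≟ j)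
      where
      entry : Bool → ℤ
      entry b = if b then ℤ.+ (4 ℕ.* t) else ℤ.+ 0
      by-cases : (∃₂ λ a b → a < t × i ≡ idx a b) → (∃₂ λ c d → c < t × j ≡ idx c d) → Dec (i ≡ j) →
                 ∑ℤ 1 (4 ℕ.* t) (λ k → ψM t x i k ℤ.* ψM t x j k) ≡ entry (i ≡ᵇ j)
      by-cases (a , b , a<t , refl) _ (yes refl) = trans (row-norm x a b) (sym (cong entry (≡ᵇ-refl (idx a b))))
      by-cases (a , b , a<t , refl) (c , d , c<t , refl) (no i≢j) =
        trans (subst (λ z → ∑ℤ 1 (4 ℕ.* t) (λ k → ψM t x z k ℤ.* ψM t x (idx c d) k) ≡ ℤ.+ 0) g·j≡i
                (row-orthogonal x bal (b ⊞ d) c d (m%n<n (a ℕ.+ (t ∸ c)) t) g≢1))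
              (sym (cong entry (≢⇒≡ᵇ-false i≢j)))
        where
        g·j≡i = jj-difference b d a<t c<t
        g≢1 : (a ℕ.+ (t ∸ c)) % t ≡ 0 → b ⊞ d ≢ 0F
        g≢1 m≡0 e≡0 = i≢j (trans (sym g·j≡i)
          (trans (cong₂ (λ m e → jj t (idx m e) (idx c d)) m≡0 e≡0) (jj-identityˡ d c<t)))

    -- Index 1 is the identity of G, so the inner product of row `l + 4` with row 1 is already
    -- R(l+4) up to the sign `C`; a second factor `C` removes the sign.
    hadamard⇒balanced : ∀ x → IsHadamard (4 ℕ.* t) (ψM t x) → RowsBalanced x
    hadamard⇒balanced x had {l} 1≤l l≤ with idx-surjective {l ℕ.+ 4} (ℕ.≤-trans 1≤l (ℕ.m≤m+n l 4)) l+4≤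
      where
      l+4≤ : l ℕ.+ 4 ≤ 4 ℕ.* t
      l+4≤ = ≤.begin
        l ℕ.+ 4                       ≤.≤⟨ ℕ.+-monoˡ-≤ 4 (ℕ.≤-trans l≤ (ℕ.≤-reflexive 2t∸2≡4half)) ⟩
        4 ℕ.* half ℕ.+ 4              ≤.≤⟨ ℕ.m≤m+n _ (4 ℕ.* half) ⟩
        4 ℕ.* half ℕ.+ 4 ℕ.+ 4 ℕ.* half
          ≤.≡⟨ solve 1 (λ h → con 4 :* h :+ con 4 :+ con 4 :* h := con 4 :* (con 1 :+ h :* con 2)) refl half ⟩
        4 ℕ.* (1 ℕ.+ half ℕ.* 2)      ≤.≡⟨ cong (4 ℕ.*_) t≡1+2half ⟨
        4 ℕ.* t                       ≤.∎
        where
        module ≤ = ℕ.≤-Reasoning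
        open Data.Nat.Solver.+-*-Solver
    ... | a , b , a<t , l+4≡ = begin
      R x (l ℕ.+ 4)                     ≡⟨ cong (R x) l+4≡ ⟩
      R x i                             ≡⟨ ℤ.*-identityˡ (R x i) ⟨
      ℤ.+ 1 ℤ.* R x i                   ≡⟨ cong (ℤ._* R x i) C² ⟨
      (C ℤ.* C) ℤ.* R x i               ≡⟨ ℤ.*-assoc C C (R x i) ⟩
      C ℤ.* (C ℤ.* R x i)               ≡⟨ cong (C ℤ.*_) (row-product x a b 0 0F) ⟨
      C ℤ.* ∑ℤ 1 (4 ℕ.* t) (λ k → ψM t x (jj t i 1) k ℤ.* ψM t x 1 k)
        ≡⟨ cong (C ℤ.*_) (trans (cong (λ z → ∑ℤ 1 (4 ℕ.* t) (λ k → ψM t x z k ℤ.* ψM t x 1 k)) i·1) orthogonal) ⟩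
      C ℤ.* ℤ.+ 0                       ≡⟨ ℤ.*-zeroʳ C ⟩
      ℤ.+ 0                             ∎
      where
      i = idx a b
      C = f x (jj t i 1) ℤ.* f x 1 ℤ.* χ b 0F
      C² : C ℤ.* C ≡ ℤ.+ 1
      C² = trans (solve 3 (λ p q s → (p :* q :* s) :* (p :* q :* s) := (p :* p) :* (q :* q) :* (s :* s)) refl
          (f x (jj t i 1)) (f x 1) (χ b 0F))
        (cong₂ ℤ._*_ (cong₂ ℤ._*_ (f² x (jj t i 1)) (f² x 1)) (χ² b 0F))
        where open Data.Integer.Solver.+-*-Solver
      i·1 : jj t i 1 ≡ i
      i·1 = trans (jj-idx a b 0 0F) (cong₂ idx (trans (cong (_% t) (ℕ.+-identityʳ a)) (m<n⇒m%n≡m a<t)) (⊞-identityʳ b))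
      i≢1 : i ≢ 1
      i≢1 i≡1 = ℕ.m+1+n≢0 l (ℕ.suc-injective (trans (sym (ℕ.+-suc l 3)) (trans l+4≡ i≡1)))
      orthogonal : ∑ℤ 1 (4 ℕ.* t) (λ k → ψM t x i k ℤ.* ψM t x 1 k) ≡ ℤ.+ 0
      orthogonal = trans (had i 1 (s≤s z≤n) (idx-≤ b a<t) (s≤s z≤n) (idx-≤ 0F 0<t))
        (cong (λ z → if z then ℤ.+ (4 ℕ.* t) else ℤ.+ 0) (≢⇒≡ᵇ-false i≢1))

    private
      n = half ℕ.* 2

      -- Here `n` is t - 1, the first coordinate of the last coset. In this form the truncated
      -- subtractions `4 * t ∸ 2` and `4 * t ∸ 3` compute.
      4t≡ : 4 ℕ.* t ≡ 4 ℕ.+ 4 ℕ.* n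
      4t≡ = trans (cong (4 ℕ.*_) t≡1+2half) (ℕ.*-suc 4 n)

      n<t : n < t
      n<t = ℕ.≤-reflexive (sym t≡1+2half)

    -- The variable of ∂_h is x_{h-1}, stored at position h - 2 counted from 0.
    inner⇒coordinate : ∀ {h} → inner h ≡ true → ∃ λ (i : Fin (nv t)) → h ∸ 1 ≡ suc (toℕ i)
    inner⇒coordinate {suc zero} ()
    inner⇒coordinate {suc (suc k)} e = F.fromℕ< k<nv , cong suc (sym (F.toℕ-fromℕ< k<nv))
      where
      k+2≤ : suc (suc k) ≤ 4 ℕ.* t ∸ 2
      k+2≤ = ℕ.≤ᵇ⇒≤ (suc (suc k)) _ (subst T (sym e) tt)
      k<nv : k < nv t
      k<nv = subst (k <_) (sym (cong (_∸ 3) 4t≡)) (ℕ.≤-pred (subst (suc (suc k) ≤_) (cong (_∸ 2) 4t≡) k+2≤))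

    coordinate⇒inner : ∀ (i : Fin (nv t)) → inner (suc (suc (toℕ i))) ≡ true
    coordinate⇒inner i = inner-true (s≤s (s≤s z≤n) , subst (suc (suc (toℕ i)) ≤_) (sym (cong (_∸ 2) 4t≡))
      (s≤s (subst (toℕ i <_) (cong (_∸ 3) 4t≡) (F.toℕ<n i))))

    -- These are the indices 4t - 1 and 4t, just beyond the last coboundary ∂_{4t-2}.
    f-last : ∀ x b → 2 ≤ toℕ b → f x (idx n b) ≡ ℤ.+ 1
    f-last x b 2≤b = cong (λ z → if z then (if at x false (idx n b ∸ 1) then ℤ.- ℤ.+ 1 else ℤ.+ 1) else ℤ.+ 1) outer
      where
      outer : inner (idx n b) ≡ false
      outer with inner (idx n b) in e
      ... | false = refl
      ... | true  = contradiction (ℕ.≤ᵇ⇒≤ (idx n b) _ (proj₂ (Bool.T-∧ .Equivalence.to (subst T (sym e) tt))))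
        (ℕ.<⇒≱ (subst (_< idx n b) (sym (cong (_∸ 2) 4t≡)) (s≤s
          (subst (ℕ._≤ 4 ℕ.* n ℕ.+ toℕ b) (ℕ.+-comm (4 ℕ.* n) 2) (ℕ.+-monoʳ-≤ (4 ℕ.* n) 2≤b)))))

    -- If ψ_x = ψ_y then F = f_x f_y is a homomorphism G → {±1}; it is trivial on ℤ_t because t is
    -- odd, and at the last two elements of G because those carry no coboundary.
    module Injectivity (x y : Vec Bool (nv t))
      (ψ≡ : ∀ i j → 1 ≤ i → i ≤ 4 ℕ.* t → 1 ≤ j → j ≤ 4 ℕ.* t → ψM t x i j ≡ ψM t y i j) where

      F : ℕ → ℤ
      F h = f x h ℤ.* f y h

      F² : ∀ h → F h ℤ.* F h ≡ ℤ.+ 1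
      F² h = trans (solve 2 (λ p q → (p :* q) :* (p :* q) := (p :* p) :* (q :* q)) refl (f x h) (f y h))
        (cong₂ ℤ._*_ (f² x h) (f² y h))
        where open Data.Integer.Solver.+-*-Solver

      -- In ψ_x ψ_y the two copies of ρ cancel and the coboundary of `F` remains. As ψ_x = ψ_y, this
      -- product is a square of signs, hence 1, and a function with trivial coboundary is
      -- multiplicative.
      F-hom : ∀ {a} b {c} d → a < t → c < t → F (idx ((a ℕ.+ c) % t) (b ⊞ d)) ≡ F (idx a b) ℤ.* F (idx c d)
      F-hom {a} b {c} d a<t c<t = trans (cong F (sym (jj-idx a b c d))) (begin
        F k                                        ≡⟨ solve 1 (λ p → p := con (ℤ.+ 1) :* (con (ℤ.+ 1) :* con (ℤ.+ 1)) :* p) refl (F k) ⟩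
        ℤ.+ 1 ℤ.* (ℤ.+ 1 ℤ.* ℤ.+ 1) ℤ.* F k        ≡⟨ cong (ℤ._* F k) (cong₂ ℤ._*_ (χ² b d) (cong₂ ℤ._*_ (F² i) (F² j))) ⟨
        (h ℤ.* h) ℤ.* ((F i ℤ.* F i) ℤ.* (F j ℤ.* F j)) ℤ.* F k
          ≡⟨ solve 7 (λ h xi xj xk yi yj yk →
               (h :* h) :* (((xi :* yi) :* (xi :* yi)) :* ((xj :* yj) :* (xj :* yj))) :* (xk :* yk)
               := ((h :* (xi :* xj :* xk)) :* (h :* (yi :* yj :* yk))) :* ((xi :* yi) :* (xj :* yj)))
               refl h (f x i) (f x j) (f x k) (f y i) (f y j) (f y k) ⟩
        ((h ℤ.* (f x i ℤ.* f x j ℤ.* f x k)) ℤ.* (h ℤ.* (f y i ℤ.* f y j ℤ.* f y k))) ℤ.* (F i ℤ.* F j)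
          ≡⟨ cong (ℤ._* (F i ℤ.* F j)) (cong₂ ℤ._*_
               (trans (ψ-χ x) (ψ≡ i j (s≤s z≤n) (idx-≤ b a<t) (s≤s z≤n) (idx-≤ d c<t))) (ψ-χ y)) ⟩
        (ψM t y i j ℤ.* ψM t y i j) ℤ.* (F i ℤ.* F j)  ≡⟨ cong (ℤ._* (F i ℤ.* F j)) (ψM² y a b c d) ⟩
        ℤ.+ 1 ℤ.* (F i ℤ.* F j)                    ≡⟨ ℤ.*-identityˡ (F i ℤ.* F j) ⟩
        F i ℤ.* F j                                ∎)
        where
        open Data.Integer.Solver.+-*-Solver
        i = idx a b
        j = idx c d
        k = jj t i j
        h = χ b d
        ψ-χ : ∀ z → h ℤ.* (f z i ℤ.* f z j ℤ.* f z k) ≡ ψM t z i j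
        ψ-χ z = sym (trans (ψM-f z i j) (cong (ℤ._* (f z i ℤ.* f z j ℤ.* f z k)) (r-idx a b c d)))

      -- An even `a` is halved directly; an odd `a` is replaced by the even number a + t, whose half
      -- is `a / 2 + half + 1`.
      halve : ∀ {a} → a < t → ∃ λ c → (c ℕ.+ c) % t ≡ a
      halve {a} a<t with a % 2 | m≡m%n+[m/n]*n a 2 | m%n<n a 2
      ... | zero        | a≡ | _ = a / 2 , trans (cong (_% t) (trans (double (a / 2)) (sym a≡))) (m<n⇒m%n≡m a<t)
        where
        double : ∀ k → k ℕ.+ k ≡ k ℕ.* 2
        double = solve 1 (λ k → k :+ k := k :* con 2) refl
          where open Data.Nat.Solver.+-*-Solver
      ... | suc zero    | a≡ | _ = suc (a / 2 ℕ.+ half) ,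
          trans (cong (_% t) (trans (double (a / 2) half) (sym (cong₂ ℕ._+_ a≡ t≡1+2half))))
          (trans ([m+n]%n≡m%n a t) (m<n⇒m%n≡m a<t))
        where
        double : ∀ k l → suc (k ℕ.+ l) ℕ.+ suc (k ℕ.+ l) ≡ (1 ℕ.+ k ℕ.* 2) ℕ.+ (1 ℕ.+ l ℕ.* 2)
        double = solve 2 (λ k l → con 1 :+ (k :+ l) :+ (con 1 :+ (k :+ l)) := con 1 :+ k :* con 2 :+ (con 1 :+ l :* con 2)) refl
          where open Data.Nat.Solver.+-*-Solver
      ... | suc (suc _) | _  | s≤s (s≤s ())

      F-cyclic : ∀ {a} → a < t → F (idx a 0F) ≡ ℤ.+ 1
      F-cyclic {a} a<t with c , 2c≡a ← halve a<t = begin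
        -- `halve` does not bound `c`, so `c` is reduced modulo `t` before `F-hom` applies; then
        -- F(2c) = F(c)² = 1.
        F (idx a 0F)                             ≡⟨ cong (λ z → F (idx z 0F)) (trans (sym 2c≡a) (%-distribˡ-+ c c t)) ⟩
        F (idx ((c % t ℕ.+ c % t) % t) 0F)       ≡⟨ F-hom 0F 0F (m%n<n c t) (m%n<n c t) ⟩
        F (idx (c % t) 0F) ℤ.* F (idx (c % t) 0F) ≡⟨ F² (idx (c % t) 0F) ⟩
        ℤ.+ 1                                      ∎

      F-coset : ∀ {a} b → a < t → F (idx a b) ≡ F (idx 0 b)
      F-coset {a} b a<t = begin
        F (idx a b)                    ≡⟨ cong (λ z → F (idx z b)) (trans (cong (_% t) (ℕ.+-identityʳ a)) (m<n⇒m%n≡m a<t)) ⟨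
        F (idx ((a ℕ.+ 0) % t) b)      ≡⟨ F-hom 0F b a<t 0<t ⟩
        F (idx a 0F) ℤ.* F (idx 0 b) ≡⟨ cong (ℤ._* F (idx 0 b)) (F-cyclic a<t) ⟩
        ℤ.+ 1 ℤ.* F (idx 0 b)          ≡⟨ ℤ.*-identityˡ (F (idx 0 b)) ⟩
        F (idx 0 b)                    ∎

      F-last : ∀ b → 2 ≤ toℕ b → F (idx 0 b) ≡ ℤ.+ 1
      F-last b 2≤b = trans (sym (F-coset b n<t)) (cong₂ ℤ._*_ (f-last x b 2≤b) (f-last y b 2≤b))

      -- `F` is constant on the cosets of ℤ_t, so its values at 2 and 3 can be read off in the last
      -- block; they determine the value at 1, since 1 = 2 + 3 in ℤ₂².
      F-klein : ∀ b → F (idx 0 b) ≡ ℤ.+ 1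
      F-klein 0F = F-cyclic 0<t
      F-klein 1F = trans (cong (λ z → F (idx z 1F)) (sym (m<n⇒m%n≡m 0<t)))
        (trans (F-hom 2F 3F 0<t 0<t) (cong₂ ℤ._*_ (F-klein 2F) (F-klein 3F)))
      F-klein 2F = F-last 2F (s≤s (s≤s z≤n))
      F-klein 3F = F-last 3F (s≤s (s≤s z≤n))

      f-equal : ∀ {h} → 1 ≤ h → h ≤ 4 ℕ.* t → f x h ≡ f y h
      f-equal {h} 1≤h h≤ with a , b , a<t , refl ← idx-surjective 1≤h h≤ = begin
        f x h                          ≡⟨ ℤ.*-identityʳ (f x h) ⟨
        f x h ℤ.* ℤ.+ 1                ≡⟨ cong (f x h ℤ.*_) (f² y h) ⟨
        f x h ℤ.* (f y h ℤ.* f y h)    ≡⟨ ℤ.*-assoc (f x h) (f y h) (f y h) ⟨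
        F h ℤ.* f y h                  ≡⟨ cong (ℤ._* f y h) (trans (F-coset b a<t) (F-klein b)) ⟩
        ℤ.+ 1 ℤ.* f y h                ≡⟨ ℤ.*-identityˡ (f y h) ⟩
        f y h                          ∎

      lookup-equal : ∀ i → V.lookup x i ≡ V.lookup y i
      lookup-equal i = sign-injective (V.lookup x i) (V.lookup y i)
        (trans (sym (f-coordinate x)) (trans (f-equal (s≤s z≤n) h≤) (f-coordinate y)))
        where
        h = suc (suc (toℕ i))
        sign : Bool → ℤ
        sign b = if b then ℤ.- ℤ.+ 1 else ℤ.+ 1
        sign-injective : ∀ b c → sign b ≡ sign c → b ≡ c
        sign-injective true  true  _ = refl
        sign-injective false false _ = refl
        f-coordinate : ∀ z → f z h ≡ sign (V.lookup z i)
        f-coordinate z = trans (cong (λ b → if b then sign (at z false (suc (toℕ i))) else ℤ.+ 1) (coordinate⇒inner i))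
          (cong sign (at-lookup z false i))
        h≤ : h ≤ 4 ℕ.* t
        h≤ = ℕ.≤-trans (ℕ.≤ᵇ⇒≤ h _ (subst T (sym (coordinate⇒inner i)) tt)) (ℕ.m∸n≤m (4 ℕ.* t) 2)

      vectors-equal : x ≡ y
      vectors-equal = trans (sym (V.tabulate∘lookup x)) (trans (V.tabulate-cong lookup-equal) (V.tabulate∘lookup y))

-- From integers to rationals, and reindexing of lists

ℤtoℚ-injective : ∀ {i j} → ℤtoℚ i ≡ ℤtoℚ j → i ≡ j
ℤtoℚ-injective {i} {j} e = trans (sym (ℤ.*-identityʳ i))
  (trans (ℚᵘ.drop-*≡* (ℚ.fromℚᵘ-injective {ℚᵘ.mkℚᵘ i 0} {ℚᵘ.mkℚᵘ j 0} e)) (ℤ.*-identityʳ j))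

-- The quotient `z / 1` is normalised by a gcd that is stuck on a variable `z`; among unnormalised
-- fractions the denominator 1 is preserved by computation.
ℤtoℚ-+ : ∀ i j → ℤtoℚ (i ℤ.+ j) ≡ ℤtoℚ i ℚ.+ ℤtoℚ j
ℤtoℚ-+ i j = ℚ.toℚᵘ-injective (begin
  ℚ.toℚᵘ (ℤtoℚ (i ℤ.+ j))                   ≈⟨ ℚ.toℚᵘ-fromℚᵘ (ℚᵘ.mkℚᵘ (i ℤ.+ j) 0) ⟩
  ℚᵘ.mkℚᵘ (i ℤ.+ j) 0                       ≡⟨ cong (λ z → ℚᵘ.mkℚᵘ z 0) (cong₂ ℤ._+_ (ℤ.*-identityʳ i) (ℤ.*-identityʳ j)) ⟨
  ℚᵘ.mkℚᵘ i 0 ℚᵘ.+ ℚᵘ.mkℚᵘ j 0              ≈⟨ ℚᵘ.+-cong (ℚ.toℚᵘ-fromℚᵘ (ℚᵘ.mkℚᵘ i 0)) (ℚ.toℚᵘ-fromℚᵘ (ℚᵘ.mkℚᵘ j 0)) ⟨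
  ℚ.toℚᵘ (ℤtoℚ i) ℚᵘ.+ ℚ.toℚᵘ (ℤtoℚ j)      ≈⟨ ℚ.toℚᵘ-homo-+ (ℤtoℚ i) (ℤtoℚ j) ⟨
  ℚ.toℚᵘ (ℤtoℚ i ℚ.+ ℤtoℚ j)                ∎)
  where open Relation.Binary.Reasoning.Setoid ℚᵘ.≃-setoid

ℤtoℚ-* : ∀ i j → ℤtoℚ (i ℤ.* j) ≡ ℤtoℚ i ℚ.* ℤtoℚ j
ℤtoℚ-* i j = ℚ.toℚᵘ-injective (begin
  ℚ.toℚᵘ (ℤtoℚ (i ℤ.* j))                   ≈⟨ ℚ.toℚᵘ-fromℚᵘ (ℚᵘ.mkℚᵘ (i ℤ.* j) 0) ⟩
  ℚᵘ.mkℚᵘ i 0 ℚᵘ.* ℚᵘ.mkℚᵘ j 0              ≈⟨ ℚᵘ.*-cong (ℚ.toℚᵘ-fromℚᵘ (ℚᵘ.mkℚᵘ i 0)) (ℚ.toℚᵘ-fromℚᵘ (ℚᵘ.mkℚᵘ j 0)) ⟨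
  ℚ.toℚᵘ (ℤtoℚ i) ℚᵘ.* ℚ.toℚᵘ (ℤtoℚ j)      ≈⟨ ℚ.toℚᵘ-homo-* (ℤtoℚ i) (ℤtoℚ j) ⟨
  ℚ.toℚᵘ (ℤtoℚ i ℚ.* ℤtoℚ j)                ∎)
  where open Relation.Binary.Reasoning.Setoid ℚᵘ.≃-setoid

ℤtoℚ-∑ : ∀ {A : Set} (xs : List A) f → ℤtoℚ (ℤΣ.sum xs f) ≡ ℚΣ.sum xs (ℤtoℚ ∘ f)
ℤtoℚ-∑ []       f = refl
ℤtoℚ-∑ (x ∷ xs) f = trans (ℤtoℚ-+ (f x) (ℤΣ.sum xs f)) (cong (ℤtoℚ (f x) ℚ.+_) (ℤtoℚ-∑ xs f))

idempotent⇒bool : ∀ q → q ℚ.* q ℚ.- q ≡ 0ℚ → ∃ λ b → q ≡ boolℚ b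
idempotent⇒bool q e with q ℚ.≟ 0ℚ
... | yes q≡0 = false , q≡0
... | no  q≢0 = true , (begin
  q                       ≡⟨ ℚ.*-identityˡ q ⟨
  1ℚ ℚ.* q                ≡⟨ cong (ℚ._* q) (ℚ.*-inverseˡ q) ⟨
  (ℚ.1/ q ℚ.* q) ℚ.* q    ≡⟨ ℚ.*-assoc (ℚ.1/ q) q q ⟩
  ℚ.1/ q ℚ.* (q ℚ.* q)    ≡⟨ cong (ℚ.1/ q ℚ.*_) q²≡q ⟩
  ℚ.1/ q ℚ.* q            ≡⟨ ℚ.*-inverseˡ q ⟩
  1ℚ                      ∎)
  where
  open ≡-Reasoning
  instance
    nz : ℚ.NonZero q
    nz = ℚ.≢-nonZero q≢0
  q²≡q : q ℚ.* q ≡ q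
  q²≡q = begin
    q ℚ.* q                      ≡⟨ ℚ.+-identityʳ (q ℚ.* q) ⟨
    q ℚ.* q ℚ.+ 0ℚ               ≡⟨ cong (q ℚ.* q ℚ.+_) (ℚ.+-inverseˡ q) ⟨
    q ℚ.* q ℚ.+ (ℚ.- q ℚ.+ q)    ≡⟨ ℚ.+-assoc (q ℚ.* q) (ℚ.- q) q ⟨
    (q ℚ.* q ℚ.- q) ℚ.+ q        ≡⟨ cong (ℚ._+ q) e ⟩
    0ℚ ℚ.+ q                     ≡⟨ ℚ.+-identityˡ q ⟩
    q                            ∎

map-lookup-allFin : ∀ {A : Set} (xs : List A) → L.map (L.lookup xs) (L.allFin (length xs)) ≡ xs
map-lookup-allFin xs = trans (L.map-tabulate id (L.lookup xs)) (L.tabulate-lookup xs)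

lookup-injective : ∀ {A : Set} {xs : List A} → Unique xs → ∀ i j → L.lookup xs i ≡ L.lookup xs j → i ≡ j
lookup-injective (_ ∷ _)  F.zero    F.zero    _ = refl
lookup-injective (x∉ ∷ _) F.zero    (F.suc j) e = contradiction e (All.lookup x∉ (∈.∈-lookup j))
lookup-injective (x∉ ∷ _) (F.suc i) F.zero    e = contradiction (sym e) (All.lookup x∉ (∈.∈-lookup i))
lookup-injective (_ ∷ u)  (F.suc i) (F.suc j) e = cong F.suc (lookup-injective u i j e)

-- The ideal, its variety and the dimension of the quotient

module CocyclicIdeal (t : ℕ) .{{_ : NonZero t}} (t-odd : t % 2 ≡ 1) where
  open Cocycle t
  open OddOrder t-odd
  open Polynomial {nv t}
  open Interpolation {nv t}
  open Ideals ≋-ring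
  open LinearCombination ≋-ring
  open CommutativeRing ≋-ring using (+-cong; +-identityˡ; +-identityʳ; *-congˡ; distribˡ)
    renaming (trans to ≋-trans; sym to ≋-sym; refl to ≋-refl)
  open Algebra.Properties.CommutativeSemigroup (CommutativeRing.+-commutativeSemigroup ≋-ring) using (interchange)

  private
    vars = range 1 (nv t)
    rows = range 1 (2 ℕ.* t ∸ 2)

    combination : (c d : ℕ → Poly (nv t)) → Poly (nv t)
    combination c d = comb vars (fieldGen t) c +ₚ comb rows (S t) d

    0ₚ : ℕ → Poly (nv t)
    0ₚ _ = []

  InJ-intro : ∀ {p} c d → p ≋ combination c d → InJ t p
  InJ-intro c d e = c , d , ≋⇒≈ₚ e

  InJ-elim : ∀ {p} → InJ t p → ∃₂ λ c d → p ≋ combination c d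
  InJ-elim {p} (c , d , e) = c , d , ≈ₚ⇒≋ {p} {combination c d} e

  InJ-isIdeal : IsIdeal (InJ t)
  InJ-isIdeal = record
    { resp = λ {p} {q} → resp p q
    ; 0∈   = InJ-intro 0ₚ 0ₚ (≋-sym (≋-trans (+-cong (comb-0 vars G) (comb-0 rows H)) (+-identityˡ [])))
    ; +∈   = λ {p} {q} → +∈ p q
    ; *∈   = λ q {p} → *∈ q p
    }
    where
    G = fieldGen t
    H = S t
    resp : ∀ p q → p ≋ q → InJ t p → InJ t q
    resp p q p≋q p∈ with c , d , e ← InJ-elim {p} p∈ = InJ-intro c d (≋-trans (≋-sym p≋q) e)
    +∈ : ∀ p q → InJ t p → InJ t q → InJ t (p +ₚ q)
    +∈ p q p∈ q∈ with c , d , e ← InJ-elim {p} p∈ | c′ , d′ , e′ ← InJ-elim {q} q∈ =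
      InJ-intro (λ k → c k +ₚ c′ k) (λ k → d k +ₚ d′ k) (≋-trans (+-cong e e′)
        (≋-trans (interchange (comb vars G c) (comb rows H d) (comb vars G c′) (comb rows H d′))
          (≋-sym (+-cong (comb-+ vars G c c′) (comb-+ rows H d d′)))))
    *∈ : ∀ q p → InJ t p → InJ t (q *ₚ p)
    *∈ q p p∈ with c , d , e ← InJ-elim {p} p∈ =
      InJ-intro (λ k → q *ₚ c k) (λ k → q *ₚ d k) (≋-trans (*-congˡ {q} e)
        (≋-trans (distribˡ q (comb vars G c) (comb rows H d))
          (≋-sym (+-cong (comb-* vars G q c) (comb-* rows H q d)))))

  private
    δₚ : ℕ → ℕ → Poly (nv t)
    δₚ i k = if k ≡ᵇ i then constₚ 1ℚ else []

    comb-δₚ : ∀ {lo hi} g i → i ∈ range lo hi → comb (range lo hi) g (δₚ i) ≋ g i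
    comb-δₚ {lo} {hi} g i i∈ = comb-single g {δₚ i} i (range-unique lo hi) i∈ δ-one δ-zero
      where
      δ-one : δₚ i i ≋ constₚ 1ℚ
      δ-one rewrite ≡ᵇ-refl i = ≋-refl
      δ-zero : ∀ {k} → k ≢ i → δₚ i k ≋ []
      δ-zero k≢i rewrite ≢⇒≡ᵇ-false k≢i = ≋-refl

  fieldGen∈J : ∀ i → InJ t (fieldGen t (suc (toℕ i)))
  fieldGen∈J i = InJ-intro (δₚ k) 0ₚ (≋-sym (≋-trans
      (+-cong (comb-δₚ {1} {nv t} (fieldGen t) k (∈-range⁺ (s≤s z≤n) (F.toℕ<n i))) (comb-0 rows (S t))) (+-identityʳ (fieldGen t k))))
    where k = suc (toℕ i)

  S∈J : ∀ {l} → 1 ≤ l → l ≤ 2 ℕ.* t ∸ 2 → InJ t (S t l)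
  S∈J {l} 1≤l l≤ = InJ-intro 0ₚ (δₚ l) (≋-sym (≋-trans
    (+-cong (comb-0 vars (fieldGen t)) (comb-δₚ {1} {2 ℕ.* t ∸ 2} (S t) l (∈-range⁺ 1≤l l≤))) (+-identityˡ (S t l))))

  eval-comb : ∀ a xs g c → (∀ {k} → k ∈ xs → evalₚ a (g k) ≡ 0ℚ) → evalₚ a (comb {A = ℕ} xs g c) ≡ 0ℚ
  eval-comb a xs g c g≡0 = trans (eval-∑ a xs (λ k → c k *ₚ g k)) (ℚΣ.sum-ε xs λ {k} k∈ →
    trans (eval-* a (c k) (g k)) (trans (cong (evalₚ a (c k) ℚ.*_) (g≡0 k∈)) (ℚ.*-zeroʳ (evalₚ a (c k)))))

  eval-J : ∀ a → (∀ {k} → k ∈ vars → evalₚ a (fieldGen t k) ≡ 0ℚ) →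
           (∀ {l} → l ∈ rows → evalₚ a (S t l) ≡ 0ℚ) → InV t a
  eval-J a field≡0 S≡0 p p∈ with c , d , e ← InJ-elim {p} p∈ = trans (eval-cong a e)
    (trans (eval-+ a (comb vars (fieldGen t) c) (comb rows (S t) d))
      (cong₂ ℚ._+_ (eval-comb a vars (fieldGen t) c field≡0) (eval-comb a rows (S t) d S≡0)))

  eval-fieldGen : ∀ a i → evalₚ a (fieldGen t (suc (toℕ i))) ≡ V.lookup a i ℚ.* V.lookup a i ℚ.- V.lookup a i
  eval-fieldGen a i = trans (eval-- a (var i *ₚ var i) (var i))
    (cong₂ ℚ._-_ (trans (eval-* a (var i) (var i)) (cong₂ ℚ._*_ (eval-var a i) (eval-var a i))) (eval-var a i))

  -- At a bit b the polynomial 1 - 2x takes the value (-1)^b, so `fac` is the polynomial form of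
  -- `f`, with the same default 1 outside the range.
  eval-fac : ∀ x k → evalₚ (map boolℚ x) (fac t k) ≡ ℤtoℚ (f x k)
  eval-fac x k = by-cases (inner k) refl
    where
    a = map boolℚ x
    two = constₚ (ℤtoℚ (ℤ.+ 2))
    sign : Bool → ℤ
    sign b = if b then ℤ.- ℤ.+ 1 else ℤ.+ 1
    1-2b : ∀ b → 1ℚ ℚ.- ℤtoℚ (ℤ.+ 2) ℚ.* boolℚ b ≡ ℤtoℚ (sign b)
    1-2b true  = refl
    1-2b false = refl
    eval-1-2x : ∀ {m} → (∃ λ (i : Fin (nv t)) → m ≡ suc (toℕ i)) →
                evalₚ a (constₚ 1ℚ -ₚ two *ₚ varₚ m) ≡ ℤtoℚ (sign (at x false m))
    eval-1-2x (i , refl) = begin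
      evalₚ a (constₚ 1ℚ -ₚ two *ₚ var i)     ≡⟨ eval-- a (constₚ 1ℚ) (two *ₚ var i) ⟩
      evalₚ a (constₚ 1ℚ) ℚ.- evalₚ a (two *ₚ var i)
        ≡⟨ cong₂ ℚ._-_ (eval-const a 1ℚ) (trans (eval-* a two (var i)) (cong₂ ℚ._*_ (eval-const a (ℤtoℚ (ℤ.+ 2)))
             (trans (eval-var a i) (trans (V.lookup-map i boolℚ x) (cong boolℚ (sym (at-lookup x false i))))))) ⟩
      1ℚ ℚ.- ℤtoℚ (ℤ.+ 2) ℚ.* boolℚ (at x false (suc (toℕ i)))
        ≡⟨ 1-2b (at x false (suc (toℕ i))) ⟩
      ℤtoℚ (sign (at x false (suc (toℕ i)))) ∎
      where open ≡-Reasoning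
    by-cases : ∀ b → inner k ≡ b →
      evalₚ a (if b then constₚ 1ℚ -ₚ two *ₚ varₚ (k ∸ 1) else constₚ 1ℚ) ≡
      ℤtoℚ (if b then sign (at x false (k ∸ 1)) else ℤ.+ 1)
    by-cases false _ = eval-const a 1ℚ
    by-cases true  e = eval-1-2x (inner⇒coordinate {k} e)

  eval-S : ∀ x l → evalₚ (map boolℚ x) (S t l) ≡ ℤtoℚ (R x (l ℕ.+ 4))
  eval-S x l = begin
    evalₚ a (S t l)                           ≡⟨ eval-∑ a (range 1 (4 ℕ.* t)) (s t l) ⟩
    ℚΣ.sum (range 1 (4 ℕ.* t)) (λ h → evalₚ a (s t l h))
      ≡⟨ ℚΣ.sum-cong (range 1 (4 ℕ.* t)) {λ h → evalₚ a (s t l h)} {ℤtoℚ ∘ summand} (λ {h} _ → term h) ⟩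
    ℚΣ.sum (range 1 (4 ℕ.* t)) (ℤtoℚ ∘ summand) ≡⟨ ℤtoℚ-∑ (range 1 (4 ℕ.* t)) summand ⟨
    ℤtoℚ (R x g)                              ∎
    where
    open ≡-Reasoning
    a = map boolℚ x
    g = l ℕ.+ 4
    summand = λ k → r t g k ℤ.* f x k ℤ.* f x (jj t g k)
    term : ∀ h → evalₚ a (s t l h) ≡ ℤtoℚ (summand h)
    term h = begin
      evalₚ a (c *ₚ fac t h *ₚ fac t (jj t g h))
        ≡⟨ trans (eval-* a (c *ₚ fac t h) (fac t (jj t g h))) (cong (ℚ._* evalₚ a (fac t (jj t g h))) (eval-* a c (fac t h))) ⟩
      evalₚ a c ℚ.* evalₚ a (fac t h) ℚ.* evalₚ a (fac t (jj t g h))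
        ≡⟨ cong₂ ℚ._*_ (cong₂ ℚ._*_ (eval-const a (ℤtoℚ (r t g h))) (eval-fac x h)) (eval-fac x (jj t g h)) ⟩
      ℤtoℚ (r t g h) ℚ.* ℤtoℚ (f x h) ℚ.* ℤtoℚ (f x (jj t g h))
        ≡⟨ trans (ℤtoℚ-* (r t g h ℤ.* f x h) (f x (jj t g h))) (cong (ℚ._* ℤtoℚ (f x (jj t g h))) (ℤtoℚ-* (r t g h) (f x h))) ⟨
      ℤtoℚ (summand h) ∎
      where c = constₚ (ℤtoℚ (r t g h))

  InV-bool⇒balanced : ∀ x → InV t (map boolℚ x) → RowsBalanced x
  InV-bool⇒balanced x inV {l} 1≤l l≤ = ℤtoℚ-injective (trans (sym (eval-S x l)) (inV (S t l) (S∈J 1≤l l≤)))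

  balanced⇒InV : ∀ x → RowsBalanced x → InV t (map boolℚ x)
  balanced⇒InV x bal = eval-J (map boolℚ x) field≡0 λ {l} l∈ → let 1≤l , l≤ = ∈-range⁻ l∈ in
      trans (eval-S x l) (cong ℤtoℚ (bal 1≤l l≤))
    where
    bool-idempotent : ∀ b → boolℚ b ℚ.* boolℚ b ℚ.- boolℚ b ≡ 0ℚ
    bool-idempotent true  = refl
    bool-idempotent false = refl
    at-coordinate : ∀ (i : Fin (nv t)) → evalₚ (map boolℚ x) (fieldGen t (suc (toℕ i))) ≡ 0ℚ
    at-coordinate i = trans (eval-fieldGen (map boolℚ x) i)
      (trans (cong (λ q → q ℚ.* q ℚ.- q) (V.lookup-map i boolℚ x)) (bool-idempotent (V.lookup x i)))
    field≡0 : ∀ {k} → k ∈ vars → evalₚ (map boolℚ x) (fieldGen t k) ≡ 0ℚ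
    field≡0 {k} k∈ with ∈-range⁻ {1} {nv t} k∈
    field≡0 {suc k} k∈ | _ , k<nv =
      subst (λ z → evalₚ (map boolℚ x) (fieldGen t (suc z)) ≡ 0ℚ)
        (F.toℕ-fromℕ< k<nv) (at-coordinate (F.fromℕ< k<nv))

  -- The generators x_i² - x_i force every coordinate of a zero to be 0 or 1, so a zero is the image
  -- of a bit vector, on which the other generators are the sums R(l+4).
  variety : ∀ a → InV t a ⇔ (∃ λ x → IsHadamard (4 ℕ.* t) (ψM t x) × a ≡ map boolℚ x)
  variety a = mk⇔ to λ { (x , had , refl) → balanced⇒InV x (hadamard⇒balanced x had) }
    where
    to : InV t a → ∃ λ x → IsHadamard (4 ℕ.* t) (ψM t x) × a ≡ map boolℚ x
    to inV = x , balanced⇒hadamard x (InV-bool⇒balanced x (subst (InV t) a≡ inV)) , a≡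
      where
      bit : ∀ (i : Fin (nv t)) → ∃ λ b → V.lookup a i ≡ boolℚ b
      bit i = idempotent⇒bool (V.lookup a i) (trans (sym (eval-fieldGen a i)) (inV (fieldGen t (suc (toℕ i))) (fieldGen∈J i)))
      x = V.tabulate (proj₁ ∘ bit)
      a≡ : a ≡ map boolℚ x
      a≡ = trans (sym (V.tabulate∘lookup a)) (trans (V.tabulate-cong (proj₂ ∘ bit)) (V.tabulate-∘ boolℚ (proj₁ ∘ bit)))

  -- `RowsBalanced` as a finite list of integer equations. This makes it decidable, so it can filter
  -- the cube, and its failure produces a row whose generator is nonzero at the point.
  Balanced : Vec Bool (nv t) → Set
  Balanced x = All (λ l → R x (l ℕ.+ 4) ≡ ℤ.+ 0) rows

  balanced? : ∀ x → Dec (Balanced x)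
  balanced? x = All.all? (λ l → R x (l ℕ.+ 4) ℤ.≟ ℤ.+ 0) rows

  Balanced⇒rows : ∀ x → Balanced x → RowsBalanced x
  Balanced⇒rows x bal 1≤l l≤ = All.lookup bal (∈-range⁺ 1≤l l≤)

  solutions : List (Vec Bool (nv t))
  solutions = L.filter balanced? (allVecs (nv t))

  solutions-unique : Unique solutions
  solutions-unique = Unique.filter⁺ balanced? (allVecs-unique (nv t))

  ∈-solutions : ∀ x → (x ∈ solutions) ⇔ IsHadamard (4 ℕ.* t) (ψM t x)
  ∈-solutions x = mk⇔ (λ x∈ → balanced⇒hadamard x (Balanced⇒rows x (proj₂ (∈.∈-filter⁻ balanced? {xs = allVecs (nv t)} x∈))))
    λ had → ∈.∈-filter⁺ balanced? (∈-allVecs x)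
      (All.tabulate λ l∈ → let 1≤l , l≤ = ∈-range⁻ l∈ in hadamard⇒balanced x had 1≤l l≤)

  open Congruence InJ-isIdeal

  non-solution : ∀ v → ¬ Balanced v → indicator id v ~ []
  non-solution v ¬bal with l , l∈ , R≢0 ← find (All.¬All⇒Any¬ (λ l → R v (l ℕ.+ 4) ℤ.≟ ℤ.+ 0) rows ¬bal) =
    indicator-vanishes InJ-isIdeal fieldGen∈J v (S t l) (S∈J (proj₁ (∈-range⁻ l∈)) (proj₂ (∈-range⁻ l∈)))
      λ e → R≢0 (ℤtoℚ-injective (trans (sym (eval-S v l)) e))

  solution-InV : ∀ i → InV t (map boolℚ (L.lookup solutions i))
  solution-InV i = balanced⇒InV v (Balanced⇒rows v
      (proj₂ (∈.∈-filter⁻ balanced? {xs = allVecs (nv t)} (∈.∈-lookup {xs = solutions} i))))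
    where v = L.lookup solutions i

  basis : Fin (length solutions) → Poly (nv t)
  basis i = indicator id (L.lookup solutions i)

  basis-spans : ∀ p → ∃ λ (a : Fin (length solutions) → ℚ) → InJ t (p -ₚ lincomb t a basis)
  basis-spans p = a , subst (λ q → InJ t (p -ₚ q)) as-lincomb
      (~⇒-∈ (interpolation InJ-isIdeal fieldGen∈J balanced? non-solution p))
    where
    open FiniteSum (CommutativeRing.+-commutativeMonoid ≋-ring) renaming (sum to ∑; sum-map to ∑-map) using ()
    term : Vec Bool (nv t) → Poly (nv t)
    term v = constₚ (evalₚ (map boolℚ v) p) *ₚ indicator id v
    a : Fin (length solutions) → ℚ
    a i = evalₚ (map boolℚ (L.lookup solutions i)) p
    -- Interpolation sums over the list of solutions, `lincomb` over positions in it; since the list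
    -- is the image of its positions under lookup, the two are the same list of terms.
    as-lincomb : ∑ solutions term ≡ lincomb t a basis
    as-lincomb = trans (cong (λ xs → ∑ xs term) (sym (map-lookup-allFin solutions)))
      (∑-map (L.lookup solutions) (L.allFin (length solutions)) term)

  eval-basis-≡ : ∀ i → evalₚ (map boolℚ (L.lookup solutions i)) (basis i) ≡ 1ℚ
  eval-basis-≡ i = eval-indicator-≡ (map boolℚ v) id v λ k → V.lookup-map k boolℚ v
    where v = L.lookup solutions i

  eval-basis-≢ : ∀ {i j} → j ≢ i → evalₚ (map boolℚ (L.lookup solutions i)) (basis j) ≡ 0ℚ
  eval-basis-≢ {i} {j} j≢i = eval-indicator-≢ (map boolℚ v) id (L.lookup solutions j) v (λ k → V.lookup-map k boolℚ v)
      λ e → j≢i (lookup-injective solutions-unique j i e)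
    where v = L.lookup solutions i

  basis-independent : ∀ a → InJ t (lincomb t a basis) → ∀ i → a i ≡ 0ℚ
  basis-independent a inJ i = begin
    a i                                              ≡⟨ ℚ.*-identityʳ (a i) ⟨
    a i ℚ.* 1ℚ                                       ≡⟨ cong (a i ℚ.*_) (eval-basis-≡ i) ⟨
    a i ℚ.* evalₚ v (basis i)                        ≡⟨ eval-term i ⟨
    evalₚ v (term i)
      ≡⟨ ℚΣ.sum-single {xs = L.allFin (length solutions)} {λ j → evalₚ v (term j)} i (Unique.allFin⁺ (length solutions)) (∈.∈-allFin i)
           (λ {j} _ j≢i → trans (eval-term j) (trans (cong (a j ℚ.*_) (eval-basis-≢ j≢i)) (ℚ.*-zeroʳ (a j)))) ⟨
    ℚΣ.sum (L.allFin (length solutions)) (λ j → evalₚ v (term j))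
      ≡⟨ eval-∑ v (L.allFin (length solutions)) term ⟨
    evalₚ v (lincomb t a basis)                      ≡⟨ solution-InV i (lincomb t a basis) inJ ⟩
    0ℚ                                               ∎
    where
    open ≡-Reasoning
    v = map boolℚ (L.lookup solutions i)
    term = λ j → constₚ (a j) *ₚ basis j
    eval-term : ∀ j → evalₚ v (term j) ≡ a j ℚ.* evalₚ v (basis j)
    eval-term j = trans (eval-* v (constₚ (a j)) (basis j)) (cong (ℚ._* evalₚ v (basis j)) (eval-const v (a j)))

open import Data.Nat using (_*_)

theorem5 : (t : ℕ) .{{_ : NonZero t}} → 1 < t → t % 2 ≡ 1 →
    ((a : Vec ℚ (nv t)) →
    InV t a ⇔ (∃ λ (x : Vec Bool (nv t)) → IsHadamard (4 * t) (ψM t x) × a ≡ map boolℚ x))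
    × ((x y : Vec Bool (nv t)) →
    (∀ i j → 1 ≤ i → i ≤ 4 * t → 1 ≤ j → j ≤ 4 * t → ψM t x i j ≡ ψM t y i j) → x ≡ y)
    × (Σ (List (Vec Bool (nv t))) λ H → Unique H
    × ((x : Vec Bool (nv t)) → (x ∈ H) ⇔ IsHadamard (4 * t) (ψM t x))
    × QuotDim t (length H))
theorem5 t _ t-odd =
  variety , Cocycle.OddOrder.Injectivity.vectors-equal t t-odd ,
  solutions , solutions-unique , ∈-solutions , basis , basis-spans , basis-independent
  where open CocyclicIdeal t t-odd
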